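{- Let $d$ be a cube-free integer which is not a perfect cube, so that $\mathbb{Q}(\sqrt[3]{d})$ is a pure cubic field. Then $$i(\mathbb{Q}(\sqrt[3]{d}))=\begin{cases}2&\text{if } d \text{ is odd},\\ 1&\text{if } d\text{ is even}.\end{cases}$$
   Context: An integer $d$ is cube-free if no prime $p$ satisfies $p^3\mid d$. For a number field $\mathbb{K}$ of degree $n$ over $\mathbb{Q}$ with ring of integers $\mathbb{A}$, let $\widehat{\mathbb{A}}$ be the set of $\theta\in\mathbb{A}$ that are primitive over $\mathbb{Q}$, i.e. $\mathbb{K}=\mathbb{Q}(\theta)$. For $\theta\in\mathbb{A}$ let $F_\theta(x)\in\mathbb{Z}[x]$ be the (degree $n$) characteristic polynomial of $\theta$ over $\mathbb{Q}$ and set $i(\theta)=\gcd_{x\in\mathbb{Z}}F_\theta(x)$. Define $i(\mathbb{K})=\operatorname{lcm}_{\theta\in\widehat{\mathbb{A}}}\, i(\theta)$. -}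

module Defs where

open import Level using (0ℓ)
open import Algebra.Bundles using (CommutativeRing)
open import Algebra.Bundles.Raw using (RawRing)
open import Algebra.Apartness.Bundles using (HeytingCommutativeRing; HeytingField)
open import Algebra.Definitions.RawSemiring using (_^_)
open import Algebra.Morphism.Structures using (IsRingHomomorphism)
import Algebra.Definitions.RawMonoid as RawMonoidDefs
open import Data.Bool.Base using (if_then_else_)
open import Data.Empty using (⊥-elim)
open import Data.Fin.Base using (Fin; zero; suc; toℕ; punchIn)
open import Data.Fin.Properties using () renaming (_≟_ to _≟ᶠ_)
open import Data.Integer.Base as ℤ using (ℤ; +_)
import Data.Integer.Divisibility as ℤDiv
import Data.Integer.Properties as ℤP
open import Data.Integer.Solver using () renaming (module +-*-Solver to ℤSolver)
open import Data.List.Base using (List; []; _∷_; map; _++_; [_])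
open import Data.Nat.Base as ℕ using (ℕ; zero; suc)
open import Data.Nat.Coprimality as Coprimality using (Coprime)
open import Data.Nat.Divisibility using (_∣_; divides; ∣-refl)
open import Data.Nat.Primality using (Prime)
import Data.Nat.Properties as ℕP
open import Data.Product.Base using (Σ; Σ-syntax; ∃-syntax; _×_; _,_; proj₁; proj₂)
open import Data.Rational.Base as ℚ using (ℚ; 0ℚ; 1ℚ; mkℚ; _/_; toℚᵘ; ↥_; ↧_; ↧ₙ_)
import Data.Rational.Properties as ℚP
open import Data.Rational.Solver using () renaming (module +-*-Solver to ℚSolver)
import Data.Rational.Unnormalised.Base as ℚᵘ
import Data.Rational.Unnormalised.Properties as ℚᵘP
open import Relation.Binary.Bundles using (DecSetoid)
open import Relation.Binary.PropositionalEquality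
  using (_≡_; _≢_; refl; sym; trans; cong; cong₂; isEquivalence; module ≡-Reasoning)
import Relation.Binary.Properties.DecSetoid as DecSetoidProperties
open import Relation.Nullary using (¬_; Dec; yes; no; does)

CubeFree : ℤ → Set
CubeFree d = ∀ p → Prime p → ¬ ((+ p) ℤ.^ 3 ℤDiv.∣ d)

PerfectCube : ℤ → Set
PerfectCube d = ∃[ k ] (k ℤ.^ 3 ≡ d)

-- gcd and lcm of a possibly infinite family, characterised by divisibility;
-- the gcd of zeros is 0, and an unbounded family has lcm 0.

IsGcd : {I : Set} → (I → ℕ) → ℕ → Set
IsGcd f g = (∀ x → g ∣ f x) × (∀ h → (∀ x → h ∣ f x) → h ∣ g)

IsLcm : {I : Set} → (I → ℕ) → ℕ → Set
IsLcm f l = (∀ x → f x ∣ l) × (∀ m → (∀ x → f x ∣ m) → l ∣ m)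

-- A polynomial is the list of its coefficients, constant term first.

module Polynomial (R : RawRing 0ℓ 0ℓ) where
  open RawRing R

  coeff : List Carrier → ℕ → Carrier
  coeff []      _       = 0#
  coeff (a ∷ p) zero    = a
  coeff (a ∷ p) (suc k) = coeff p k

  -- Trailing zeros are allowed, so equality is coefficientwise.
  infix 4 _≈ₚ_
  _≈ₚ_ : List Carrier → List Carrier → Set
  p ≈ₚ q = ∀ k → coeff p k ≈ coeff q k

  infixl 6 _+ₚ_
  _+ₚ_ : List Carrier → List Carrier → List Carrier
  []      +ₚ q       = q
  (a ∷ p) +ₚ []      = a ∷ p
  (a ∷ p) +ₚ (b ∷ q) = (a + b) ∷ (p +ₚ q)

  infixl 7 _*ₚ_
  _*ₚ_ : List Carrier → List Carrier → List Carrier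
  []      *ₚ q = []
  (a ∷ p) *ₚ q = map (a *_) q +ₚ (0# ∷ (p *ₚ q))

  rawRing : RawRing 0ℓ 0ℓ
  rawRing = record
    { Carrier = List Carrier
    ; _≈_     = _≈ₚ_
    ; _+_     = _+ₚ_
    ; _*_     = _*ₚ_
    ; -_      = map (-_)
    ; 0#      = []
    ; 1#      = [ 1# ]
    }

  X : List Carrier
  X = 0# ∷ 1# ∷ []

  evaluate : List Carrier → Carrier → Carrier
  evaluate []      x = 0#
  evaluate (a ∷ p) x = a + x * evaluate p x

module Matrix (R : RawRing 0ℓ 0ℓ) where
  open RawRing R
  open RawMonoidDefs +-rawMonoid using (sum)

  det : ∀ {n} → (Fin n → Fin n → Carrier) → Carrier
  det {zero}  M = 1#
  det {suc n} M = sum λ j →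
    (_^_ rawSemiring (- 1#) (toℕ j)) *
    (M zero j * det (λ r c → M (suc r) (punchIn j c)))

charPolyℚ : ∀ {n} → (Fin n → Fin n → ℚ) → List ℚ
charPolyℚ M = Matrix.det rawRing λ i j →
    (if does (i ≟ᶠ j) then X else []) +ₚ map (ℚ.-_) [ M i j ]
  where open Polynomial ℚ.+-*-rawRing

ℤ→ℚ : ℤ → ℚ
ℤ→ℚ k = k / 1

record NumberField (degree : ℕ) : Set₁ where
  field
    heytingField : HeytingField 0ℓ 0ℓ 0ℓ

  open HeytingField heytingField public
    using (Carrier; _≈_; _+_; _*_; -_; 0#; 1#; heytingCommutativeRing)

  rawRing : RawRing 0ℓ 0ℓ
  rawRing = CommutativeRing.rawRing (HeytingCommutativeRing.commutativeRing heytingCommutativeRing)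

  open RawMonoidDefs (RawRing.+-rawMonoid rawRing) using (sum)

  field
    ι                 : ℚ → Carrier
    ι-isHomomorphism  : IsRingHomomorphism ℚ.+-*-rawRing rawRing ι
    basis             : Fin degree → Carrier
    coords            : Carrier → Fin degree → ℚ
    basis-spans       : ∀ x → x ≈ sum (λ i → ι (coords x i) * basis i)
    basis-independent : ∀ (c : Fin degree → ℚ) → sum (λ i → ι (c i) * basis i) ≈ 0# →
                        ∀ i → c i ≡ 0ℚ

  -- θ is a root of a monic polynomial, whose non-leading coefficients are cs.
  Integral : Carrier → Set
  Integral θ = ∃[ cs ] evaluate (map (λ k → ι (ℤ→ℚ k)) (cs ++ [ + 1 ])) θ ≈ 0#
    where open Polynomial rawRing

  -- The smallest subfield containing θ.
  data ℚ⟨_⟩ (θ : Carrier) : Carrier → Set where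
    generator      : ℚ⟨ θ ⟩ θ
    rational       : ∀ q → ℚ⟨ θ ⟩ (ι q)
    addition       : ∀ {x y} → ℚ⟨ θ ⟩ x → ℚ⟨ θ ⟩ y → ℚ⟨ θ ⟩ (x + y)
    negation       : ∀ {x} → ℚ⟨ θ ⟩ x → ℚ⟨ θ ⟩ (- x)
    multiplication : ∀ {x y} → ℚ⟨ θ ⟩ x → ℚ⟨ θ ⟩ y → ℚ⟨ θ ⟩ (x * y)
    inverse        : ∀ {x y} → ℚ⟨ θ ⟩ x → x * y ≈ 1# → ℚ⟨ θ ⟩ y
    respects       : ∀ {x y} → x ≈ y → ℚ⟨ θ ⟩ x → ℚ⟨ θ ⟩ y

  Primitive : Carrier → Set
  Primitive θ = ∀ x → ℚ⟨ θ ⟩ x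

  PrimitiveInteger : Set
  PrimitiveInteger = Σ[ θ ∈ Carrier ] (Integral θ × Primitive θ)

  multiplicationMatrix : Carrier → Fin degree → Fin degree → ℚ
  multiplicationMatrix θ i j = coords (θ * basis j) i

  charPoly : Carrier → List ℚ
  charPoly θ = charPolyℚ (multiplicationMatrix θ)

  -- i(θ) = g. That the characteristic polynomial has integer coefficients is
  -- part of the assertion.
  IsElementIndex : Carrier → ℕ → Set
  IsElementIndex θ g =
    Σ[ F ∈ List ℤ ]
      (Polynomial._≈ₚ_ ℚ.+-*-rawRing (map ℤ→ℚ F) (charPoly θ)
       × IsGcd (λ x → ℤ.∣ Polynomial.evaluate ℤ.+-*-rawRing F x ∣) g)

  -- i(𝕂) = l. That i(θ) exists for every primitive integer θ is part of the assertion.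
  IsFieldIndex : ℕ → Set
  IsFieldIndex l =
    Σ[ i ∈ (PrimitiveInteger → ℕ) ]
      ((∀ θ → IsElementIndex (proj₁ θ) (i θ)) × IsLcm i l)

-- ⟨ a , b , c ⟩ stands for a + b ∛d + c ∛d².
record Cubic : Set where
  constructor ⟨_,_,_⟩
  field
    c₀ c₁ c₂ : ℚ

open Cubic

module PureCubic (d : ℤ) (d-not-cube : ¬ PerfectCube d) where

  open ≡-Reasoning
  open import Algebra.Definitions {A = Cubic} _≡_ using (Invertible)
  open import Algebra.Structures {A = Cubic} _≡_ using (IsCommutativeRing)
  open import Algebra.Apartness.Structures {Carrier = Cubic} _≡_ _≢_ using (IsHeytingField)

  D : ℚ
  D = ℤ→ℚ d

  0ᶜ 1ᶜ ∛d : Cubic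
  0ᶜ = ⟨ 0ℚ , 0ℚ , 0ℚ ⟩
  1ᶜ = ⟨ 1ℚ , 0ℚ , 0ℚ ⟩
  ∛d = ⟨ 0ℚ , 1ℚ , 0ℚ ⟩

  embed : ℚ → Cubic
  embed q = ⟨ q , 0ℚ , 0ℚ ⟩

  infixl 6 _+ᶜ_
  infixl 7 _*ᶜ_
  infix  8 -ᶜ_

  _+ᶜ_ _*ᶜ_ : Cubic → Cubic → Cubic
  ⟨ a , b , c ⟩ +ᶜ ⟨ x , y , z ⟩ = ⟨ a ℚ.+ x , b ℚ.+ y , c ℚ.+ z ⟩
  ⟨ a , b , c ⟩ *ᶜ ⟨ x , y , z ⟩ =
    ⟨ a ℚ.* x ℚ.+ D ℚ.* (b ℚ.* z ℚ.+ c ℚ.* y)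
    , a ℚ.* y ℚ.+ b ℚ.* x ℚ.+ D ℚ.* (c ℚ.* z)
    , a ℚ.* z ℚ.+ b ℚ.* y ℚ.+ c ℚ.* x ⟩

  -ᶜ_ : Cubic → Cubic
  -ᶜ ⟨ a , b , c ⟩ = ⟨ ℚ.- a , ℚ.- b , ℚ.- c ⟩

  private
    ext : ∀ {a b c x y z} → a ≡ x → b ≡ y → c ≡ z → ⟨ a , b , c ⟩ ≡ ⟨ x , y , z ⟩
    ext refl refl refl = refl

  infix 4 _≟ᶜ_
  _≟ᶜ_ : (x y : Cubic) → Dec (x ≡ y)
  ⟨ a , b , c ⟩ ≟ᶜ ⟨ x , y , z ⟩ with a ℚP.≟ x | b ℚP.≟ y | c ℚP.≟ z
  ... | yes p | yes q | yes r = yes (ext p q r)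
  ... | no ¬p | _     | _     = no λ e → ¬p (cong c₀ e)
  ... | yes _ | no ¬q | _     = no λ e → ¬q (cong c₁ e)
  ... | yes _ | yes _ | no ¬r = no λ e → ¬r (cong c₂ e)

  *ᶜ-comm : ∀ x y → x *ᶜ y ≡ y *ᶜ x
  *ᶜ-comm ⟨ a , b , c ⟩ ⟨ x , y , z ⟩ = ext
    (solve 7 (λ D a b c x y z →
       a :* x :+ D :* (b :* z :+ c :* y) := x :* a :+ D :* (y :* c :+ z :* b)) refl D a b c x y z)
    (solve 7 (λ D a b c x y z →
       a :* y :+ b :* x :+ D :* (c :* z) := x :* b :+ y :* a :+ D :* (z :* c)) refl D a b c x y z)
    (solve 7 (λ D a b c x y z →
       a :* z :+ b :* y :+ c :* x := x :* c :+ y :* b :+ z :* a) refl D a b c x y z)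
    where open ℚSolver

  *ᶜ-assoc : ∀ x y z → (x *ᶜ y) *ᶜ z ≡ x *ᶜ (y *ᶜ z)
  *ᶜ-assoc ⟨ a , b , c ⟩ ⟨ x , y , z ⟩ ⟨ u , v , w ⟩ = ext
    (solve 10 (λ D a b c x y z u v w →
       let p = a :* x :+ D :* (b :* z :+ c :* y)
           q = a :* y :+ b :* x :+ D :* (c :* z)
           r = a :* z :+ b :* y :+ c :* x
           p′ = x :* u :+ D :* (y :* w :+ z :* v)
           q′ = x :* v :+ y :* u :+ D :* (z :* w)
           r′ = x :* w :+ y :* v :+ z :* u
       in p :* u :+ D :* (q :* w :+ r :* v) := a :* p′ :+ D :* (b :* r′ :+ c :* q′))
      refl D a b c x y z u v w)
    (solve 10 (λ D a b c x y z u v w →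
       let p = a :* x :+ D :* (b :* z :+ c :* y)
           q = a :* y :+ b :* x :+ D :* (c :* z)
           r = a :* z :+ b :* y :+ c :* x
           p′ = x :* u :+ D :* (y :* w :+ z :* v)
           q′ = x :* v :+ y :* u :+ D :* (z :* w)
           r′ = x :* w :+ y :* v :+ z :* u
       in p :* v :+ q :* u :+ D :* (r :* w) := a :* q′ :+ b :* p′ :+ D :* (c :* r′))
      refl D a b c x y z u v w)
    (solve 10 (λ D a b c x y z u v w →
       let p = a :* x :+ D :* (b :* z :+ c :* y)
           q = a :* y :+ b :* x :+ D :* (c :* z)
           r = a :* z :+ b :* y :+ c :* x
           p′ = x :* u :+ D :* (y :* w :+ z :* v)
           q′ = x :* v :+ y :* u :+ D :* (z :* w)
           r′ = x :* w :+ y :* v :+ z :* u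
       in p :* w :+ q :* v :+ r :* u := a :* r′ :+ b :* q′ :+ c :* p′)
      refl D a b c x y z u v w)
    where open ℚSolver

  *ᶜ-identityˡ : ∀ x → 1ᶜ *ᶜ x ≡ x
  *ᶜ-identityˡ ⟨ x , y , z ⟩ = ext
    (solve 4 (λ D x y z →
       con 1ℚ :* x :+ D :* (con 0ℚ :* z :+ con 0ℚ :* y) := x) refl D x y z)
    (solve 4 (λ D x y z →
       con 1ℚ :* y :+ con 0ℚ :* x :+ D :* (con 0ℚ :* z) := y) refl D x y z)
    (solve 4 (λ D x y z →
       con 1ℚ :* z :+ con 0ℚ :* y :+ con 0ℚ :* x := z) refl D x y z)
    where open ℚSolver

  *ᶜ-distribˡ-+ᶜ : ∀ x y z → x *ᶜ (y +ᶜ z) ≡ x *ᶜ y +ᶜ x *ᶜ z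
  *ᶜ-distribˡ-+ᶜ ⟨ a , b , c ⟩ ⟨ x , y , z ⟩ ⟨ u , v , w ⟩ = ext
    (solve 10 (λ D a b c x y z u v w →
       a :* (x :+ u) :+ D :* (b :* (z :+ w) :+ c :* (y :+ v)) :=
       (a :* x :+ D :* (b :* z :+ c :* y)) :+ (a :* u :+ D :* (b :* w :+ c :* v)))
      refl D a b c x y z u v w)
    (solve 10 (λ D a b c x y z u v w →
       a :* (y :+ v) :+ b :* (x :+ u) :+ D :* (c :* (z :+ w)) :=
       (a :* y :+ b :* x :+ D :* (c :* z)) :+ (a :* v :+ b :* u :+ D :* (c :* w)))
      refl D a b c x y z u v w)
    (solve 10 (λ D a b c x y z u v w →
       a :* (z :+ w) :+ b :* (y :+ v) :+ c :* (x :+ u) :=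
       (a :* z :+ b :* y :+ c :* x) :+ (a :* w :+ b :* v :+ c :* u))
      refl D a b c x y z u v w)
    where open ℚSolver

  isCommutativeRing : IsCommutativeRing _+ᶜ_ _*ᶜ_ -ᶜ_ 0ᶜ 1ᶜ
  isCommutativeRing = record
    { isRing = record
      { +-isAbelianGroup = record
        { isGroup = record
          { isMonoid = record
            { isSemigroup = record
              { isMagma = record { isEquivalence = isEquivalence ; ∙-cong = cong₂ _+ᶜ_ }
              ; assoc = λ x y z → ext (ℚP.+-assoc (c₀ x) (c₀ y) (c₀ z))
                                      (ℚP.+-assoc (c₁ x) (c₁ y) (c₁ z))
                                      (ℚP.+-assoc (c₂ x) (c₂ y) (c₂ z)) }
            ; identity =
                (λ x → ext (ℚP.+-identityˡ _) (ℚP.+-identityˡ _) (ℚP.+-identityˡ _)) ,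
                (λ x → ext (ℚP.+-identityʳ _) (ℚP.+-identityʳ _) (ℚP.+-identityʳ _)) }
          ; inverse =
              (λ x → ext (ℚP.+-inverseˡ (c₀ x)) (ℚP.+-inverseˡ (c₁ x)) (ℚP.+-inverseˡ (c₂ x))) ,
              (λ x → ext (ℚP.+-inverseʳ (c₀ x)) (ℚP.+-inverseʳ (c₁ x)) (ℚP.+-inverseʳ (c₂ x)))
          ; ⁻¹-cong = cong -ᶜ_ }
        ; comm = λ x y → ext (ℚP.+-comm (c₀ x) (c₀ y)) (ℚP.+-comm (c₁ x) (c₁ y))
                             (ℚP.+-comm (c₂ x) (c₂ y)) }
      ; *-cong = cong₂ _*ᶜ_
      ; *-assoc = *ᶜ-assoc
      ; *-identity = *ᶜ-identityˡ , λ x → trans (*ᶜ-comm x 1ᶜ) (*ᶜ-identityˡ x)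
      ; distrib = *ᶜ-distribˡ-+ᶜ , λ x y z →
          trans (*ᶜ-comm (y +ᶜ z) x)
            (trans (*ᶜ-distribˡ-+ᶜ x y z) (cong₂ _+ᶜ_ (*ᶜ-comm x y) (*ᶜ-comm x z))) }
    ; *-comm = *ᶜ-comm }

  private
    noRationalRoot : ∀ r → r ℚ.* r ℚ.* r ≢ D
    noRationalRoot r@(mkℚ n m-1 coprime) r³≡D = d-not-cube (n , n³≡d)
      where
      m = suc m-1

      r³≃D : toℚᵘ r ℚᵘ.* toℚᵘ r ℚᵘ.* toℚᵘ r ℚᵘ.≃ ℚᵘ.mkℚᵘ d 0
      r³≃D = ℚᵘP.≃-trans
        (ℚᵘP.≃-sym (ℚᵘP.≃-trans (ℚP.toℚᵘ-homo-* (r ℚ.* r) r)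
                                (ℚᵘP.*-congʳ {toℚᵘ r} (ℚP.toℚᵘ-homo-* r r))))
        (ℚᵘP.≃-trans (ℚP.toℚᵘ-cong r³≡D) (ℚP.toℚᵘ-fromℚᵘ (ℚᵘ.mkℚᵘ d 0)))

      n³≡dm³ : n ℤ.* n ℤ.* n ≡ d ℤ.* + (m ℕ.* m ℕ.* m)
      n³≡dm³ with ℚᵘ.*≡* e ← r³≃D = trans (sym (ℤP.*-identityʳ (n ℤ.* n ℤ.* n))) e

      m∣n³ : m ∣ ℤ.∣ n ∣ ℕ.* (ℤ.∣ n ∣ ℕ.* ℤ.∣ n ∣)
      m∣n³ = divides (ℤ.∣ d ∣ ℕ.* (m ℕ.* m)) (begin
        ℤ.∣ n ∣ ℕ.* (ℤ.∣ n ∣ ℕ.* ℤ.∣ n ∣)  ≡⟨ ℕP.*-assoc ℤ.∣ n ∣ ℤ.∣ n ∣ ℤ.∣ n ∣ ⟨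
        ℤ.∣ n ∣ ℕ.* ℤ.∣ n ∣ ℕ.* ℤ.∣ n ∣    ≡⟨ cong (ℕ._* ℤ.∣ n ∣) (ℤP.abs-* n n) ⟨
        ℤ.∣ n ℤ.* n ∣ ℕ.* ℤ.∣ n ∣          ≡⟨ ℤP.abs-* (n ℤ.* n) n ⟨
        ℤ.∣ n ℤ.* n ℤ.* n ∣                ≡⟨ cong ℤ.∣_∣ n³≡dm³ ⟩
        ℤ.∣ d ℤ.* + (m ℕ.* m ℕ.* m) ∣      ≡⟨ ℤP.abs-* d (+ (m ℕ.* m ℕ.* m)) ⟩
        ℤ.∣ d ∣ ℕ.* (m ℕ.* m ℕ.* m)        ≡⟨ ℕP.*-assoc ℤ.∣ d ∣ (m ℕ.* m) m ⟨
        ℤ.∣ d ∣ ℕ.* (m ℕ.* m) ℕ.* m        ∎)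

      m⊥n : Coprime m ℤ.∣ n ∣
      m⊥n = Coprimality.sym (Coprimality.recompute coprime)

      m≡1 : m ≡ 1
      m≡1 = m⊥n (∣-refl ,
        Coprimality.coprime-divisor m⊥n (Coprimality.coprime-divisor m⊥n m∣n³))

      n³≡d : n ℤ.^ 3 ≡ d
      n³≡d = begin
        n ℤ.^ 3                        ≡⟨ ℤSolver.solve 1 (λ n → n ℤSolver.:^ 3 ℤSolver.:= n ℤSolver.:* n ℤSolver.:* n) refl n ⟩
        n ℤ.* n ℤ.* n                  ≡⟨ n³≡dm³ ⟩
        d ℤ.* + (m ℕ.* m ℕ.* m)        ≡⟨ cong (λ t → d ℤ.* + (t ℕ.* t ℕ.* t)) m≡1 ⟩
        d ℤ.* + 1                      ≡⟨ ℤP.*-identityʳ d ⟩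
        d                              ∎

    zeroProduct : ∀ p q → p ≢ 0ℚ → p ℚ.* q ≡ 0ℚ → q ≡ 0ℚ
    zeroProduct p q p≢0 pq≡0 = begin
      q                       ≡⟨ ℚP.*-identityˡ q ⟨
      1ℚ ℚ.* q                ≡⟨ cong (ℚ._* q) (ℚP.*-inverseˡ p) ⟨
      (ℚ.1/ p) ℚ.* p ℚ.* q    ≡⟨ ℚP.*-assoc (ℚ.1/ p) p q ⟩
      (ℚ.1/ p) ℚ.* (p ℚ.* q)  ≡⟨ cong ((ℚ.1/ p) ℚ.*_) pq≡0 ⟩
      (ℚ.1/ p) ℚ.* 0ℚ         ≡⟨ ℚP.*-zeroʳ (ℚ.1/ p) ⟩
      0ℚ                      ∎
      where instance _ = ℚ.≢-nonZero p≢0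

    cube≡0 : ∀ p → p ℚ.* p ℚ.* p ≡ 0ℚ → p ≡ 0ℚ
    cube≡0 p e with p ℚP.≟ 0ℚ
    ... | yes p≡0 = p≡0
    ... | no  p≢0 = zeroProduct p p p≢0
                      (zeroProduct p (p ℚ.* p) p≢0 (trans (sym (ℚP.*-assoc p p p)) e))

    -- p + q ∛d has norm p³ + d q³.
    linear : ∀ p q → p ℚ.* p ℚ.* p ℚ.+ D ℚ.* (q ℚ.* q ℚ.* q) ≡ 0ℚ → q ≡ 0ℚ × p ≡ 0ℚ
    linear p q e with q ℚP.≟ 0ℚ
    ... | yes refl = refl , cube≡0 p (trans
            (solve 2 (λ D p → p :* p :* p := p :* p :* p :+ D :* (con 0ℚ :* con 0ℚ :* con 0ℚ))
              refl D p) e)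
      where open ℚSolver
    ... | no q≢0 = ⊥-elim (noRationalRoot (ℚ.- (p ℚ.* s)) (begin
        ℚ.- (p ℚ.* s) ℚ.* ℚ.- (p ℚ.* s) ℚ.* ℚ.- (p ℚ.* s)
          ≡⟨ solve 4 (λ D p q s →
               :- (p :* s) :* :- (p :* s) :* :- (p :* s) :=
               D :* ((s :* q) :* (s :* q) :* (s :* q))
               :+ (:- ((p :* p :* p :+ D :* (q :* q :* q)) :* (s :* s :* s))))
             refl D p q s ⟩
        D ℚ.* ((s ℚ.* q) ℚ.* (s ℚ.* q) ℚ.* (s ℚ.* q))
          ℚ.+ ℚ.- ((p ℚ.* p ℚ.* p ℚ.+ D ℚ.* (q ℚ.* q ℚ.* q)) ℚ.* (s ℚ.* s ℚ.* s))
          ≡⟨ cong₂ (λ t u → D ℚ.* (t ℚ.* t ℚ.* t) ℚ.+ ℚ.- (u ℚ.* (s ℚ.* s ℚ.* s)))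
                   (ℚP.*-inverseˡ q) e ⟩
        D ℚ.* (1ℚ ℚ.* 1ℚ ℚ.* 1ℚ) ℚ.+ ℚ.- (0ℚ ℚ.* (s ℚ.* s ℚ.* s))
          ≡⟨ solve 2 (λ D s →
               D :* (con 1ℚ :* con 1ℚ :* con 1ℚ) :+ (:- (con 0ℚ :* (s :* s :* s))) := D)
             refl D s ⟩
        D ∎))
      where
      open ℚSolver
      instance _ = ℚ.≢-nonZero q≢0
      s = ℚ.1/ q

  norm : Cubic → ℚ
  norm ⟨ a , b , c ⟩ =
    a ℚ.* a ℚ.* a ℚ.+ D ℚ.* (b ℚ.* b ℚ.* b) ℚ.+ D ℚ.* D ℚ.* (c ℚ.* c ℚ.* c)
    ℚ.- (1ℚ ℚ.+ 1ℚ ℚ.+ 1ℚ) ℚ.* D ℚ.* (a ℚ.* b ℚ.* c)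

  adjugate : Cubic → Cubic
  adjugate ⟨ a , b , c ⟩ =
    ⟨ a ℚ.* a ℚ.- D ℚ.* (b ℚ.* c) , D ℚ.* (c ℚ.* c) ℚ.- a ℚ.* b , b ℚ.* b ℚ.- a ℚ.* c ⟩

  norm≡0⇒≡0 : ∀ x → norm x ≡ 0ℚ → x ≡ 0ᶜ
  norm≡0⇒≡0 ⟨ a , b , c ⟩ N≡0 = ext (proj₂ ab≡0) (proj₁ ab≡0) c≡0
    where
    open ℚSolver
    N = norm ⟨ a , b , c ⟩
    p = D ℚ.* (c ℚ.* c) ℚ.- a ℚ.* b
    q = a ℚ.* c ℚ.- b ℚ.* b

    -- (a + b ∛d + c ∛d²) (c ∛d - b) = p + q ∛d
    pq≡0 : q ≡ 0ℚ × p ≡ 0ℚ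
    pq≡0 = linear p q (begin
      p ℚ.* p ℚ.* p ℚ.+ D ℚ.* (q ℚ.* q ℚ.* q)
        ≡⟨ solve 4 (λ D a b c →
             let p = D :* (c :* c) :- a :* b
                 q = a :* c :- b :* b
             in p :* p :* p :+ D :* (q :* q :* q) :=
                (a :* a :* a :+ D :* (b :* b :* b) :+ D :* D :* (c :* c :* c)
                 :- (con 1ℚ :+ con 1ℚ :+ con 1ℚ) :* D :* (a :* b :* c))
                :* (D :* (c :* c :* c) :- b :* b :* b))
           refl D a b c ⟩
      N ℚ.* (D ℚ.* (c ℚ.* c ℚ.* c) ℚ.- b ℚ.* b ℚ.* b)
        ≡⟨ cong (ℚ._* (D ℚ.* (c ℚ.* c ℚ.* c) ℚ.- b ℚ.* b ℚ.* b)) N≡0 ⟩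
      0ℚ ℚ.* (D ℚ.* (c ℚ.* c ℚ.* c) ℚ.- b ℚ.* b ℚ.* b)
        ≡⟨ ℚP.*-zeroˡ (D ℚ.* (c ℚ.* c ℚ.* c) ℚ.- b ℚ.* b ℚ.* b) ⟩
      0ℚ ∎)

    c≡0 : c ≡ 0ℚ
    c≡0 = proj₁ (linear (ℚ.- b) c (begin
      (ℚ.- b) ℚ.* (ℚ.- b) ℚ.* (ℚ.- b) ℚ.+ D ℚ.* (c ℚ.* c ℚ.* c)
        ≡⟨ solve 4 (λ D a b c →
             (:- b) :* (:- b) :* (:- b) :+ D :* (c :* c :* c) :=
             b :* (a :* c :- b :* b) :+ c :* (D :* (c :* c) :- a :* b))
           refl D a b c ⟩
      b ℚ.* q ℚ.+ c ℚ.* p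
        ≡⟨ cong₂ (λ u v → b ℚ.* u ℚ.+ c ℚ.* v) (proj₁ pq≡0) (proj₂ pq≡0) ⟩
      b ℚ.* 0ℚ ℚ.+ c ℚ.* 0ℚ
        ≡⟨ cong₂ ℚ._+_ (ℚP.*-zeroʳ b) (ℚP.*-zeroʳ c) ⟩
      0ℚ ∎))

    ab≡0 : b ≡ 0ℚ × a ≡ 0ℚ
    ab≡0 = linear a b (begin
      a ℚ.* a ℚ.* a ℚ.+ D ℚ.* (b ℚ.* b ℚ.* b)
        ≡⟨ solve 3 (λ D a b →
             a :* a :* a :+ D :* (b :* b :* b) :=
             a :* a :* a :+ D :* (b :* b :* b) :+ D :* D :* (con 0ℚ :* con 0ℚ :* con 0ℚ)
             :- (con 1ℚ :+ con 1ℚ :+ con 1ℚ) :* D :* (a :* b :* con 0ℚ))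
           refl D a b ⟩
      norm ⟨ a , b , 0ℚ ⟩  ≡⟨ cong (λ t → norm ⟨ a , b , t ⟩) c≡0 ⟨
      N                    ≡⟨ N≡0 ⟩
      0ℚ                   ∎)

  embed-* : ∀ x y → embed (x ℚ.* y) ≡ embed x *ᶜ embed y
  embed-* x y = ext
    (solve 3 (λ D x y → x :* y := x :* y :+ D :* (con 0ℚ :* con 0ℚ :+ con 0ℚ :* con 0ℚ))
      refl D x y)
    (solve 3 (λ D x y → con 0ℚ := x :* con 0ℚ :+ con 0ℚ :* y :+ D :* (con 0ℚ :* con 0ℚ))
      refl D x y)
    (solve 2 (λ x y → con 0ℚ := x :* con 0ℚ :+ con 0ℚ :* con 0ℚ :+ con 0ℚ :* y)
      refl x y)
    where open ℚSolver

  *ᶜ-adjugate : ∀ x → x *ᶜ adjugate x ≡ embed (norm x)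
  *ᶜ-adjugate ⟨ a , b , c ⟩ = ext
    (solve 4 (λ D a b c →
       a :* (a :* a :- D :* (b :* c))
       :+ D :* (b :* (b :* b :- a :* c) :+ c :* (D :* (c :* c) :- a :* b)) :=
       a :* a :* a :+ D :* (b :* b :* b) :+ D :* D :* (c :* c :* c)
       :- (con 1ℚ :+ con 1ℚ :+ con 1ℚ) :* D :* (a :* b :* c))
      refl D a b c)
    (solve 4 (λ D a b c →
       a :* (D :* (c :* c) :- a :* b) :+ b :* (a :* a :- D :* (b :* c))
       :+ D :* (c :* (b :* b :- a :* c)) := con 0ℚ)
      refl D a b c)
    (solve 4 (λ D a b c →
       a :* (b :* b :- a :* c) :+ b :* (D :* (c :* c) :- a :* b)
       :+ c :* (a :* a :- D :* (b :* c)) := con 0ℚ)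
      refl D a b c)
    where open ℚSolver

  inverse : ∀ x → x ≢ 0ᶜ → Σ[ y ∈ Cubic ] x *ᶜ y ≡ 1ᶜ
  inverse x x≢0 = adjugate x *ᶜ embed s , (begin
    x *ᶜ (adjugate x *ᶜ embed s)   ≡⟨ *ᶜ-assoc x (adjugate x) (embed s) ⟨
    x *ᶜ adjugate x *ᶜ embed s     ≡⟨ cong (_*ᶜ embed s) (*ᶜ-adjugate x) ⟩
    embed (norm x) *ᶜ embed s      ≡⟨ embed-* (norm x) s ⟨
    embed (norm x ℚ.* s)           ≡⟨ cong embed (ℚP.*-inverseʳ (norm x)) ⟩
    1ᶜ                             ∎)
    where
    instance _ = ℚ.≢-nonZero (λ N≡0 → x≢0 (norm≡0⇒≡0 x N≡0))
    s : ℚ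
    s = ℚ.1/ norm x

  private
    decSetoid : DecSetoid 0ℓ 0ℓ
    decSetoid = record
      { isDecEquivalence = record { isEquivalence = isEquivalence ; _≟_ = _≟ᶜ_ } }

    x-y≡0⇒x≡y : ∀ x y → x +ᶜ -ᶜ y ≡ 0ᶜ → x ≡ y
    x-y≡0⇒x≡y ⟨ a , b , c ⟩ ⟨ x , y , z ⟩ e =
      ext (go a x (cong c₀ e)) (go b y (cong c₁ e)) (go c z (cong c₂ e))
      where
      open ℚSolver
      go : ∀ p q → p ℚ.- q ≡ 0ℚ → p ≡ q
      go p q e = begin
        p                ≡⟨ solve 2 (λ p q → p := p :- q :+ q) refl p q ⟩
        p ℚ.- q ℚ.+ q    ≡⟨ cong (ℚ._+ q) e ⟩
        0ℚ ℚ.+ q         ≡⟨ ℚP.+-identityˡ q ⟩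
        q                ∎

    ≢⇒invertible : ∀ {x y} → x ≢ y → Invertible 1ᶜ _*ᶜ_ (x +ᶜ -ᶜ y)
    ≢⇒invertible {x} {y} x≢y =
      proj₁ y′ , trans (*ᶜ-comm (proj₁ y′) (x +ᶜ -ᶜ y)) (proj₂ y′) , proj₂ y′
      where y′ = inverse (x +ᶜ -ᶜ y) (λ e → x≢y (x-y≡0⇒x≡y x y e))

    invertible⇒≢ : ∀ {x y} → Invertible 1ᶜ _*ᶜ_ (x +ᶜ -ᶜ y) → x ≢ y
    invertible⇒≢ {x} (z , _ , e) refl = 0≢1 (begin
      0ᶜ                 ≡⟨ zeroˡ z ⟨
      0ᶜ *ᶜ z            ≡⟨ cong (_*ᶜ z) (-‿inverseʳ x) ⟨
      (x +ᶜ -ᶜ x) *ᶜ z   ≡⟨ e ⟩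
      1ᶜ                 ∎)
      where
      open IsCommutativeRing isCommutativeRing using (zeroˡ; -‿inverseʳ)
      0≢1 : 0ᶜ ≢ 1ᶜ
      0≢1 ()

  isHeytingField : IsHeytingField _+ᶜ_ _*ᶜ_ -ᶜ_ 0ᶜ 1ᶜ
  isHeytingField = record
    { isHeytingCommutativeRing = record
      { isCommutativeRing   = isCommutativeRing
      ; isApartnessRelation = DecSetoidProperties.≉-isApartnessRelation decSetoid
      ; #⇒invertible        = ≢⇒invertible
      ; invertible⇒#        = invertible⇒≢ }
    ; tight = DecSetoidProperties.≉-tight decSetoid }

  numberField : NumberField 3
  numberField = record
    { heytingField     = record { isHeytingField = isHeytingField }
    ; ι                = embed
    ; ι-isHomomorphism = record
      { isSemiringHomomorphism = record
        { isNearSemiringHomomorphism = record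
          { +-isMonoidHomomorphism = record
            { isMagmaHomomorphism = record
              { isRelHomomorphism = record { cong = cong embed }
              ; homo = λ _ _ → refl }
            ; ε-homo = refl }
          ; *-homo = embed-* }
        ; 1#-homo = refl }
      ; -‿homo = λ _ → refl }
    ; basis             = basis
    ; coords            = coords
    ; basis-spans       = λ x → sym (combination (c₀ x) (c₁ x) (c₂ x))
    ; basis-independent = λ c e → λ where
        zero             → cong c₀ (trans (sym (combination (c zero) (c (suc zero)) (c (suc (suc zero))))) e)
        (suc zero)       → cong c₁ (trans (sym (combination (c zero) (c (suc zero)) (c (suc (suc zero))))) e)
        (suc (suc zero)) → cong c₂ (trans (sym (combination (c zero) (c (suc zero)) (c (suc (suc zero))))) e)
    }
    where
    open ℚSolver

    basis : Fin 3 → Cubic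
    basis zero             = 1ᶜ
    basis (suc zero)       = ∛d
    basis (suc (suc zero)) = ∛d *ᶜ ∛d

    coords : Cubic → Fin 3 → ℚ
    coords x zero             = c₀ x
    coords x (suc zero)       = c₁ x
    coords x (suc (suc zero)) = c₂ x

    scale : ∀ q x → embed q *ᶜ x ≡ ⟨ q ℚ.* c₀ x , q ℚ.* c₁ x , q ℚ.* c₂ x ⟩
    scale q ⟨ x , y , z ⟩ = ext
      (solve 5 (λ D q x y z → q :* x :+ D :* (con 0ℚ :* z :+ con 0ℚ :* y) := q :* x) refl D q x y z)
      (solve 5 (λ D q x y z → q :* y :+ con 0ℚ :* x :+ D :* (con 0ℚ :* z) := q :* y) refl D q x y z)
      (solve 4 (λ q x y z → q :* z :+ con 0ℚ :* y :+ con 0ℚ :* x := q :* z) refl q x y z)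

    ∛d² : ∛d *ᶜ ∛d ≡ ⟨ 0ℚ , 0ℚ , 1ℚ ⟩
    ∛d² = ext
      (solve 1 (λ D → con 0ℚ :* con 0ℚ :+ D :* (con 1ℚ :* con 0ℚ :+ con 0ℚ :* con 1ℚ) := con 0ℚ) refl D)
      (solve 1 (λ D → con 0ℚ :* con 1ℚ :+ con 1ℚ :* con 0ℚ :+ D :* (con 0ℚ :* con 0ℚ) := con 0ℚ) refl D)
      refl

    combination : ∀ a b c →
      embed a *ᶜ 1ᶜ +ᶜ (embed b *ᶜ ∛d +ᶜ (embed c *ᶜ (∛d *ᶜ ∛d) +ᶜ 0ᶜ)) ≡ ⟨ a , b , c ⟩
    combination a b c = begin
      embed a *ᶜ 1ᶜ +ᶜ (embed b *ᶜ ∛d +ᶜ (embed c *ᶜ (∛d *ᶜ ∛d) +ᶜ 0ᶜ))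
        ≡⟨ cong₂ _+ᶜ_ (scale a 1ᶜ) (cong₂ _+ᶜ_ (scale b ∛d)
             (cong (_+ᶜ 0ᶜ) (trans (cong (embed c *ᶜ_) ∛d²) (scale c _)))) ⟩
      ⟨ a ℚ.* 1ℚ , a ℚ.* 0ℚ , a ℚ.* 0ℚ ⟩ +ᶜ (⟨ b ℚ.* 0ℚ , b ℚ.* 1ℚ , b ℚ.* 0ℚ ⟩
        +ᶜ (⟨ c ℚ.* 0ℚ , c ℚ.* 0ℚ , c ℚ.* 1ℚ ⟩ +ᶜ 0ᶜ))
        ≡⟨ ext
             (solve 3 (λ a b c → a :* con 1ℚ :+ (b :* con 0ℚ :+ (c :* con 0ℚ :+ con 0ℚ)) := a) refl a b c)
             (solve 3 (λ a b c → a :* con 0ℚ :+ (b :* con 1ℚ :+ (c :* con 0ℚ :+ con 0ℚ)) := b) refl a b c)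
             (solve 3 (λ a b c → a :* con 0ℚ :+ (b :* con 0ℚ :+ (c :* con 1ℚ :+ con 0ℚ)) := c) refl a b c) ⟩
      ⟨ a , b , c ⟩ ∎

  ∛d-primitive : NumberField.Primitive numberField ∛d
  ∛d-primitive x = respects (sym (basis-spans x))
    (addition {x = x₀} {y = x₁ + (x₂ + 0ᶜ)} (term (c₀ x) (rational 1ℚ))
      (addition {x = x₁} {y = x₂ + 0ᶜ} (term (c₁ x) generator)
        (addition {x = x₂} {y = 0ᶜ} (term (c₂ x) (multiplication generator generator))
          (rational 0ℚ))))
    where
    open NumberField numberField
    x₀ x₁ x₂ : Cubic
    x₀ = embed (c₀ x) *ᶜ 1ᶜ
    x₁ = embed (c₁ x) *ᶜ ∛d
    x₂ = embed (c₂ x) *ᶜ (∛d *ᶜ ∛d)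
    term : ∀ q {y} → ℚ⟨ ∛d ⟩ y → ℚ⟨ ∛d ⟩ (embed q *ᶜ y)
    term q {y} = multiplication {x = embed q} {y = y} (rational q)

  ∛d-cubed : ∛d *ᶜ ∛d *ᶜ ∛d ≡ embed D
  ∛d-cubed = ext
    (solve 1 (λ D →
       let z = con 0ℚ ; o = con 1ℚ
           p = z :* z :+ D :* (o :* z :+ z :* o)
           q = z :* o :+ o :* z :+ D :* (z :* z)
           r = z :* z :+ o :* o :+ z :* z
       in p :* z :+ D :* (q :* z :+ r :* o) := D) refl D)
    (solve 1 (λ D →
       let z = con 0ℚ ; o = con 1ℚ
           p = z :* z :+ D :* (o :* z :+ z :* o)
           q = z :* o :+ o :* z :+ D :* (z :* z)
           r = z :* z :+ o :* o :+ z :* z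
       in p :* o :+ q :* z :+ D :* (r :* z) := con 0ℚ) refl D)
    (solve 1 (λ D →
       let z = con 0ℚ ; o = con 1ℚ
           p = z :* z :+ D :* (o :* z :+ z :* o)
           q = z :* o :+ o :* z :+ D :* (z :* z)
           r = z :* z :+ o :* o :+ z :* z
       in p :* z :+ q :* o :+ r :* z := con 0ℚ) refl D)
    where open ℚSolver

ℚ[∛_] : (d : ℤ) → ¬ PerfectCube d → NumberField 3
ℚ[∛ d ] = PureCubic.numberField d

{-# OPTIONS --safe #-}
module Submission where

-- Write F = x³ - T x² + S x - N for the characteristic polynomial of an integral
-- θ = a + b∛d + c∛d².  The gcd i(θ) of its values divides 3! = 6.  With P = T² - 3S and
-- Q = 27N + 2T³ - 9TS, the integers d(3b)³ and d²(3c)³ have sum Q and product P³.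
-- If 3 divides every value of F, then 3 divides P exactly once and 27 divides Q, so these
-- two integers would have equal 3-adic valuations adding up to 3, which is odd.  If d and
-- every value of F are even, then P is odd, so d(3b)³ is odd, although its 2-adic
-- valuation is that of d modulo 3, which is 1 or 2 because d is cube-free.  For odd d, the
-- polynomial x³ - 3dx - (d² + d) of ∛d + ∛d² takes only even values.
--
-- That T, S and N are integers is shown without Gauss's lemma: the powers of an element z
-- of ℤ[θ] have bounded denominators, hence so have those of its norm, which is therefore
-- an integer; apply this to θ, 1 ± θ and 1 + θ².

open import Algebra.Bundles using (CommutativeRing)
open import Algebra.Bundles.Raw using (RawRing)
import Algebra.Properties.Semiring.Exp as Exp
import Algebra.Solver.Ring as RingSolver
import Algebra.Solver.Ring.AlmostCommutativeRing as ACR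
open import Data.Bool.Base using (if_then_else_)
open import Data.Empty using (⊥; ⊥-elim)
open import Data.Fin.Base using (Fin; zero; suc)
open import Data.Fin.Patterns using (0F; 1F; 2F; 3F)
open import Data.Fin.Properties using () renaming (_≟_ to _≟ᶠ_)
open import Data.Integer.Base as ℤ using (ℤ; +_; -[1+_])
open import Data.Integer.Divisibility using (_∣_)
open import Data.Integer.Divisibility.Signed as ℤ∣ using (divides) renaming (_∣_ to _∣ℤ_)
import Data.Integer.Properties as ℤP
open import Data.Integer.Solver using () renaming (module +-*-Solver to ℤSolver)
open import Data.List.Base using (List; []; _∷_; _++_; [_]; map; length)
open import Data.Maybe.Base as Maybe using (Maybe)
open import Data.Nat.Base as ℕ using (ℕ; zero; suc; NonZero; s≤s; z≤n)
open import Data.Nat.Coprimality as Coprimality using (Coprime)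
open import Data.Nat.Divisibility as ℕ∣ using (∣1⇒≡1; ∣-refl; ∣-trans; 1∣_; ∣⇒≤; *-monoˡ-∣; ∣m⇒∣m*n)
  renaming (_∣_ to _∣ℕ_)
open import Data.Nat.GCD using (gcd; gcd[m,n]∣m; gcd[m,n]∣n; gcd-greatest)
open import Data.Nat.Primality using (Prime; prime?; prime[2]; euclidsLemma; prime⇒irreducible)
import Data.Nat.Properties as ℕP
open import Data.Product.Base using (Σ-syntax; ∃-syntax; _×_; _,_; proj₁; proj₂)
open import Data.Rational.Base as ℚ using (ℚ; 0ℚ; 1ℚ; mkℚ; ↥_; ↧_; ↧ₙ_; toℚᵘ)
import Data.Rational.Properties as ℚP
open import Data.Rational.Solver using () renaming (module +-*-Solver to ℚSolver)
import Data.Rational.Unnormalised.Base as ℚᵘ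
import Data.Rational.Unnormalised.Properties as ℚᵘP
open import Data.Sum.Base using (inj₁; inj₂)
import Data.Vec.Base as Vec
import Data.Vec.Properties as VecP
open import Level using (0ℓ)
open import Relation.Binary.PropositionalEquality
  using (_≡_; _≢_; refl; sym; trans; cong; cong₂; subst; subst₂; module ≡-Reasoning)
open import Relation.Nullary using (¬_; does; dec⇒maybe)
open import Relation.Nullary.Decidable using (from-yes)
open import Defs

open ≡-Reasoning

private
  module Q = ℚSolver
  module Z = ℤSolver

-- Integers among the rationals

toℚᵘ-ℤ→ℚ : ∀ k → toℚᵘ (ℤ→ℚ k) ℚᵘ.≃ ℚᵘ.mkℚᵘ k 0
toℚᵘ-ℤ→ℚ k = ℚP.toℚᵘ-fromℚᵘ (ℚᵘ.mkℚᵘ k 0)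

ℤ→ℚ-injective : ∀ {j k} → ℤ→ℚ j ≡ ℤ→ℚ k → j ≡ k
ℤ→ℚ-injective {j} {k} e
  with ℚᵘ.*≡* e′ ← ℚᵘP.≃-trans (ℚᵘP.≃-sym (toℚᵘ-ℤ→ℚ j)) (ℚᵘP.≃-trans (ℚP.toℚᵘ-cong e) (toℚᵘ-ℤ→ℚ k))
  = trans (sym (ℤP.*-identityʳ j)) (trans e′ (ℤP.*-identityʳ k))

ℤ→ℚ-+ : ∀ j k → ℤ→ℚ (j ℤ.+ k) ≡ ℤ→ℚ j ℚ.+ ℤ→ℚ k
ℤ→ℚ-+ j k = ℚP.toℚᵘ-injective (ℚᵘP.≃-trans (toℚᵘ-ℤ→ℚ (j ℤ.+ k)) (ℚᵘP.≃-trans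
  (ℚᵘ.*≡* (ℤSolver.solve 2 (λ j k → (j :+ k) :* con (+ 1) := (j :* con (+ 1) :+ k :* con (+ 1)) :* con (+ 1)) refl j k))
  (ℚᵘP.≃-sym (ℚᵘP.≃-trans (ℚP.toℚᵘ-homo-+ (ℤ→ℚ j) (ℤ→ℚ k))
    (ℚᵘP.+-cong (toℚᵘ-ℤ→ℚ j) (toℚᵘ-ℤ→ℚ k))))))
  where open ℤSolver

ℤ→ℚ-* : ∀ j k → ℤ→ℚ (j ℤ.* k) ≡ ℤ→ℚ j ℚ.* ℤ→ℚ k
ℤ→ℚ-* j k = ℚP.toℚᵘ-injective (ℚᵘP.≃-trans (toℚᵘ-ℤ→ℚ (j ℤ.* k)) (ℚᵘP.≃-trans
  (ℚᵘ.*≡* refl)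
  (ℚᵘP.≃-sym (ℚᵘP.≃-trans (ℚP.toℚᵘ-homo-* (ℤ→ℚ j) (ℤ→ℚ k))
    (ℚᵘP.*-cong (toℚᵘ-ℤ→ℚ j) (toℚᵘ-ℤ→ℚ k))))))

ℤ→ℚ-neg : ∀ k → ℤ→ℚ (ℤ.- k) ≡ ℚ.- ℤ→ℚ k
ℤ→ℚ-neg k = ℚP.toℚᵘ-injective (ℚᵘP.≃-trans (toℚᵘ-ℤ→ℚ (ℤ.- k))
  (ℚᵘP.≃-sym (ℚᵘP.≃-trans (ℚP.toℚᵘ-homo‿- (ℤ→ℚ k)) (ℚᵘP.-‿cong (toℚᵘ-ℤ→ℚ k)))))

private
  module ℤExp = Exp (CommutativeRing.semiring ℤP.+-*-commutativeRing)
  module ℚExp = Exp (CommutativeRing.semiring ℚP.+-*-commutativeRing)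

ℤ→ℚ-^ : ∀ k n → ℤ→ℚ (k ℤExp.^ n) ≡ ℤ→ℚ k ℚExp.^ n
ℤ→ℚ-^ k zero    = refl
ℤ→ℚ-^ k (suc n) = trans (ℤ→ℚ-* k _) (cong (ℤ→ℚ k ℚ.*_) (ℤ→ℚ-^ k n))

-- Polynomial expressions in the syntax of the ring solvers serve to move
-- whole identities between ℤ and ℚ.
rationalise : ∀ {n} → ℤSolver.Polynomial n → ℚSolver.Polynomial n
rationalise (ℤSolver.op ℤSolver.[+] p q) = ℚSolver.op ℚSolver.[+] (rationalise p) (rationalise q)
rationalise (ℤSolver.op ℤSolver.[*] p q) = ℚSolver.op ℚSolver.[*] (rationalise p) (rationalise q)
rationalise (ℤSolver.con c)     = ℚSolver.con (ℤ→ℚ c)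
rationalise (ℤSolver.var x)     = ℚSolver.var x
rationalise (p ℤSolver.:^ n)    = rationalise p ℚSolver.:^ n
rationalise (ℤSolver.:- p)      = ℚSolver.:- rationalise p

ℤ→ℚ-⟦⟧ : ∀ {n} (p : ℤSolver.Polynomial n) ρ →
         ℤ→ℚ (ℤSolver.⟦ p ⟧ ρ) ≡ ℚSolver.⟦ rationalise p ⟧ (Vec.map ℤ→ℚ ρ)
ℤ→ℚ-⟦⟧ (ℤSolver.op ℤSolver.[+] p q) ρ =
  trans (ℤ→ℚ-+ (ℤSolver.⟦ p ⟧ ρ) (ℤSolver.⟦ q ⟧ ρ)) (cong₂ ℚ._+_ (ℤ→ℚ-⟦⟧ p ρ) (ℤ→ℚ-⟦⟧ q ρ))
ℤ→ℚ-⟦⟧ (ℤSolver.op ℤSolver.[*] p q) ρ =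
  trans (ℤ→ℚ-* (ℤSolver.⟦ p ⟧ ρ) (ℤSolver.⟦ q ⟧ ρ)) (cong₂ ℚ._*_ (ℤ→ℚ-⟦⟧ p ρ) (ℤ→ℚ-⟦⟧ q ρ))
ℤ→ℚ-⟦⟧ (ℤSolver.con c)  ρ = refl
ℤ→ℚ-⟦⟧ (ℤSolver.var x)  ρ = sym (VecP.lookup-map x ℤ→ℚ ρ)
ℤ→ℚ-⟦⟧ (p ℤSolver.:^ n) ρ = trans (ℤ→ℚ-^ (ℤSolver.⟦ p ⟧ ρ) n) (cong (ℚExp._^ n) (ℤ→ℚ-⟦⟧ p ρ))
ℤ→ℚ-⟦⟧ (ℤSolver.:- p)   ρ = trans (ℤ→ℚ-neg (ℤSolver.⟦ p ⟧ ρ)) (cong ℚ.-_ (ℤ→ℚ-⟦⟧ p ρ))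

ℚ⇒ℤ : ∀ {n} (p q : ℤSolver.Polynomial n) ρ →
      ℚSolver.⟦ rationalise p ⟧ (Vec.map ℤ→ℚ ρ) ≡ ℚSolver.⟦ rationalise q ⟧ (Vec.map ℤ→ℚ ρ) →
      ℤSolver.⟦ p ⟧ ρ ≡ ℤSolver.⟦ q ⟧ ρ
ℚ⇒ℤ p q ρ e = ℤ→ℚ-injective {ℤSolver.⟦ p ⟧ ρ} {ℤSolver.⟦ q ⟧ ρ} (trans (ℤ→ℚ-⟦⟧ p ρ) (trans e (sym (ℤ→ℚ-⟦⟧ q ρ))))

-- Criteria for a rational number to be an integer.

IsInteger : ℚ → Set
IsInteger q = ∃[ z ] q ≡ ℤ→ℚ z

+-isInteger : ∀ {p q} → IsInteger p → IsInteger q → IsInteger (p ℚ.+ q)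
+-isInteger (j , refl) (k , refl) = j ℤ.+ k , sym (ℤ→ℚ-+ j k)

*-isInteger : ∀ {p q} → IsInteger p → IsInteger q → IsInteger (p ℚ.* q)
*-isInteger (j , refl) (k , refl) = j ℤ.* k , sym (ℤ→ℚ-* j k)

neg-isInteger : ∀ {p} → IsInteger p → IsInteger (ℚ.- p)
neg-isInteger (k , refl) = ℤ.- k , sym (ℤ→ℚ-neg k)

p*↧p≡↥p : ∀ p → p ℚ.* ℤ→ℚ (↧ p) ≡ ℤ→ℚ (↥ p)
p*↧p≡↥p p@(mkℚ n m-1 _) = ℚP.toℚᵘ-injective
  (ℚᵘP.≃-trans (ℚP.toℚᵘ-homo-* p (ℤ→ℚ (↧ p)))
  (ℚᵘP.≃-trans (ℚᵘP.*-congˡ {toℚᵘ p} (toℚᵘ-ℤ→ℚ (↧ p)))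
  (ℚᵘP.≃-trans (ℚᵘ.*≡* (begin
    n ℤ.* + suc m-1 ℤ.* + 1              ≡⟨ ℤP.*-identityʳ _ ⟩
    n ℤ.* + suc m-1                      ≡⟨ cong (λ t → n ℤ.* + t) (ℕP.*-identityʳ (suc m-1)) ⟨
    n ℤ.* + (suc m-1 ℕ.* 1)              ∎))
  (ℚᵘP.≃-sym (toℚᵘ-ℤ→ℚ (↥ p))))))

↧-coprime-↥ : ∀ p → Coprime (↧ₙ p) ℤ.∣ ↥ p ∣
↧-coprime-↥ (mkℚ _ _ coprime) = Coprimality.sym (Coprimality.recompute coprime)

↧ₙ≡1⇒isInteger : ∀ p → ↧ₙ p ≡ 1 → IsInteger p
↧ₙ≡1⇒isInteger p e = ↥ p , (begin
  p                     ≡⟨ ℚP.*-identityʳ p ⟨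
  p ℚ.* 1ℚ              ≡⟨ cong (λ t → p ℚ.* ℤ→ℚ (+ t)) e ⟨
  p ℚ.* ℤ→ℚ (↧ p)       ≡⟨ p*↧p≡↥p p ⟩
  ℤ→ℚ (↥ p)             ∎)

coprime-^ : ∀ {m n} k → Coprime m n → Coprime (m ℕ.^ k) n
coprime-^ zero    c (d∣1 , _)    = ∣1⇒≡1 d∣1
coprime-^ (suc k) c (d∣m^ , d∣n) = coprime-^ k c
  (Coprimality.coprime-divisor (λ (e∣d , e∣m) → c (e∣m , ∣-trans e∣d d∣n)) d∣m^ , d∣n)

n<[2+m]^n : ∀ m n → n ℕ.< (2 ℕ.+ m) ℕ.^ n
n<[2+m]^n m zero    = s≤s z≤n
n<[2+m]^n m (suc n) = ℕP.<-≤-trans (s≤s (n<[2+m]^n m n))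
  (ℕP.≤-trans (ℕP.+-monoˡ-≤ _ (ℕP.m^n>0 (2 ℕ.+ m) n))
              (ℕP.+-monoʳ-≤ ((2 ℕ.+ m) ℕ.^ n) (ℕP.m≤m+n _ _)))

-- Let q = n/m in lowest terms and let z k be the integer `w k`. Then z k · n = z (k+1) · m, and
-- since mʲ is coprime to n, divisibility of z (k+1) by mʲ lifts to divisibility of z k by mʲ⁺¹.
-- Hence every power of m divides the nonzero integer z 0, which forces m = 1.
geometric⇒isInteger : (w : ℕ → ℚ) (q : ℚ) → (∀ k → IsInteger (w k)) →
                      (∀ k → w (suc k) ≡ w k ℚ.* q) → w 0 ≢ 0ℚ → IsInteger q
geometric⇒isInteger w q w∈ℤ step w₀≢0 = ↧ₙ≡1⇒isInteger q m≡1
  where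
  m = ↧ₙ q
  n = ℤ.∣ ↥ q ∣
  z = λ k → proj₁ (w∈ℤ k)

  zn≡zm : ∀ k → ℤ.∣ z k ∣ ℕ.* n ≡ ℤ.∣ z (suc k) ∣ ℕ.* m
  zn≡zm k = trans (sym (ℤP.abs-* (z k) (↥ q))) (trans (cong ℤ.∣_∣ (ℤ→ℚ-injective {z k ℤ.* ↥ q} {z (suc k) ℤ.* ↧ q} (begin
    ℤ→ℚ (z k ℤ.* ↥ q)                  ≡⟨ ℤ→ℚ-* (z k) (↥ q) ⟩
    ℤ→ℚ (z k) ℚ.* ℤ→ℚ (↥ q)            ≡⟨ cong₂ ℚ._*_ (proj₂ (w∈ℤ k)) (p*↧p≡↥p q) ⟨
    w k ℚ.* (q ℚ.* ℤ→ℚ (↧ q))          ≡⟨ ℚP.*-assoc (w k) q (ℤ→ℚ (↧ q)) ⟨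
    w k ℚ.* q ℚ.* ℤ→ℚ (↧ q)            ≡⟨ cong (ℚ._* ℤ→ℚ (↧ q)) (trans (sym (step k)) (proj₂ (w∈ℤ (suc k)))) ⟩
    ℤ→ℚ (z (suc k)) ℚ.* ℤ→ℚ (↧ q)      ≡⟨ ℤ→ℚ-* (z (suc k)) (↧ q) ⟨
    ℤ→ℚ (z (suc k) ℤ.* ↧ q)            ∎))) (ℤP.abs-* (z (suc k)) (↧ q)))

  m^j∣z : ∀ j k → m ℕ.^ j ∣ℕ ℤ.∣ z k ∣
  m^j∣z zero    k = 1∣ _
  m^j∣z (suc j) k = Coprimality.coprime-divisor (coprime-^ (suc j) (↧-coprime-↥ q))
    (subst₂ _∣ℕ_ (ℕP.*-comm (m ℕ.^ j) m) (trans (sym (zn≡zm k)) (ℕP.*-comm ℤ.∣ z k ∣ n))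
      (*-monoˡ-∣ m (m^j∣z j (suc k))))

  z₀≢0 : ℤ.∣ z 0 ∣ ≢ 0
  z₀≢0 e = w₀≢0 (trans (proj₂ (w∈ℤ 0)) (cong ℤ→ℚ (ℤP.∣i∣≡0⇒i≡0 {z 0} e)))

  bounded⇒≡1 : ∀ m .{{_ : NonZero m}} → (∀ j → m ℕ.^ j ∣ℕ ℤ.∣ z 0 ∣) → m ≡ 1
  bounded⇒≡1 1             _     = refl
  -- For a base of at least 2 the exponent ∣z 0∣ already gives a power exceeding ∣z 0∣.
  bounded⇒≡1 (suc (suc m)) m^j∣z = ⊥-elim (ℕP.<⇒≱ (n<[2+m]^n m ℤ.∣ z 0 ∣)
    (∣⇒≤ {{ℕ.≢-nonZero z₀≢0}} (m^j∣z ℤ.∣ z 0 ∣)))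

  m≡1 : m ≡ 1
  m≡1 = bounded⇒≡1 m (λ j → m^j∣z j 0)

-- For q = n/m in lowest terms, clearing denominators gives n² = (-bn - cm)m. So m divides n², and
-- being coprime to n it is 1.
quadraticRoot⇒isInteger : ∀ (b c : ℤ) q → q ℚ.* q ℚ.+ ℤ→ℚ b ℚ.* q ℚ.+ ℤ→ℚ c ≡ 0ℚ → IsInteger q
quadraticRoot⇒isInteger b c q root = ↧ₙ≡1⇒isInteger q
  (m⊥n (∣-refl , Coprimality.coprime-divisor m⊥n (subst (m ∣ℕ_) (ℤP.abs-* n n)
    (ℕ∣.divides ℤ.∣ ℤ.- (b ℤ.* n) ℤ.- c ℤ.* + m ∣
      (trans (cong ℤ.∣_∣ n²) (ℤP.abs-* (ℤ.- (b ℤ.* n) ℤ.- c ℤ.* + m) (+ m)))))))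
  where
  m = ↧ₙ q
  n = ↥ q
  m⊥n = ↧-coprime-↥ q

  n² : n ℤ.* n ≡ (ℤ.- (b ℤ.* n) ℤ.- c ℤ.* + m) ℤ.* + m
  n² = ℚ⇒ℤ (var 0F :* var 0F)
         ((:- (var 1F :* var 0F) :+ :- (var 2F :* var 3F)) :* var 3F)
         (n Vec.∷ b Vec.∷ c Vec.∷ + m Vec.∷ Vec.[]) (begin
    ℤ→ℚ n ℚ.* ℤ→ℚ n
      ≡⟨ cong (λ t → t ℚ.* t) (p*↧p≡↥p q) ⟨
    q ℚ.* M ℚ.* (q ℚ.* M)
      ≡⟨ Q.solve 4 (λ q M b c →
           q Q.:* M Q.:* (q Q.:* M) Q.:=
           (Q.:- (b Q.:* (q Q.:* M)) Q.:- c Q.:* M) Q.:* M Q.:+ (q Q.:* q Q.:+ b Q.:* q Q.:+ c) Q.:* (M Q.:* M))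
         refl q M (ℤ→ℚ b) (ℤ→ℚ c) ⟩
    (ℚ.- (ℤ→ℚ b ℚ.* (q ℚ.* M)) ℚ.- ℤ→ℚ c ℚ.* M) ℚ.* M ℚ.+ (q ℚ.* q ℚ.+ ℤ→ℚ b ℚ.* q ℚ.+ ℤ→ℚ c) ℚ.* (M ℚ.* M)
      ≡⟨ cong₂ (λ s t → (ℚ.- (ℤ→ℚ b ℚ.* s) ℚ.- ℤ→ℚ c ℚ.* M) ℚ.* M ℚ.+ t ℚ.* (M ℚ.* M)) (p*↧p≡↥p q) root ⟩
    (ℚ.- (ℤ→ℚ b ℚ.* ℤ→ℚ n) ℚ.- ℤ→ℚ c ℚ.* M) ℚ.* M ℚ.+ 0ℚ ℚ.* (M ℚ.* M)
      ≡⟨ cong ((ℚ.- (ℤ→ℚ b ℚ.* ℤ→ℚ n) ℚ.- ℤ→ℚ c ℚ.* M) ℚ.* M ℚ.+_) (ℚP.*-zeroˡ (M ℚ.* M)) ⟩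
    (ℚ.- (ℤ→ℚ b ℚ.* ℤ→ℚ n) ℚ.- ℤ→ℚ c ℚ.* M) ℚ.* M ℚ.+ 0ℚ
      ≡⟨ ℚP.+-identityʳ _ ⟩
    (ℚ.- (ℤ→ℚ b ℚ.* ℤ→ℚ n) ℚ.- ℤ→ℚ c ℚ.* M) ℚ.* M
      ∎)
    where
    open ℤSolver
    M = ℤ→ℚ (+ m)

-- Values of monic cubic polynomials

prime[3] : Prime 3
prime[3] = from-yes (prime? 3)

prime∣square : ∀ {p} → Prime p → ∀ x → + p ∣ℤ x ℤ.* x → + p ∣ℤ x
prime∣square {p} p-prime x p∣x²
  with euclidsLemma ℤ.∣ x ∣ ℤ.∣ x ∣ p-prime (subst (p ∣ℕ_) (ℤP.abs-* x x) (ℤ∣.∣⇒∣ᵤ p∣x²))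
... | inj₁ p∣x = ℤ∣.∣ᵤ⇒∣ p∣x
... | inj₂ p∣x = ℤ∣.∣ᵤ⇒∣ p∣x

prime∣cube : ∀ {p} → Prime p → ∀ x → + p ∣ℤ x ℤ.* x ℤ.* x → + p ∣ℤ x
prime∣cube {p} p-prime x p∣x³
  with euclidsLemma ℤ.∣ x ℤ.* x ∣ ℤ.∣ x ∣ p-prime
         (subst (p ∣ℕ_) (ℤP.abs-* (x ℤ.* x) x) (ℤ∣.∣⇒∣ᵤ p∣x³))
... | inj₁ p∣x² = prime∣square p-prime x (ℤ∣.∣ᵤ⇒∣ p∣x²)
... | inj₂ p∣x  = ℤ∣.∣ᵤ⇒∣ p∣x

-- Substituting q = p + 2r gives 4e = 2p² + 4(pr + r²), so p² is even, hence p, hence q.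
sum-of-squares-even : ∀ p q r e → + 4 ℤ.* e ≡ p ℤ.* p ℤ.+ q ℤ.* q → q ≡ p ℤ.+ + 2 ℤ.* r → + 2 ∣ℤ q
sum-of-squares-even p q r e sum refl =
  ℤ∣.∣m∣n⇒∣m+n (prime∣square prime[2] p (divides (e ℤ.- p ℤ.* r ℤ.- r ℤ.* r)
      (ℤP.*-cancelʳ-≡ _ _ (+ 2) (begin
        p ℤ.* p ℤ.* + 2
          ≡⟨ solve 2 (λ p r → p :* p :* con (+ 2) :=
               (p :* p :+ (p :+ con (+ 2) :* r) :* (p :+ con (+ 2) :* r)) :- con (+ 4) :* (p :* r :+ r :* r)) refl p r ⟩
        (p ℤ.* p ℤ.+ q ℤ.* q) ℤ.- + 4 ℤ.* (p ℤ.* r ℤ.+ r ℤ.* r)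
          ≡⟨ cong (ℤ._- + 4 ℤ.* (p ℤ.* r ℤ.+ r ℤ.* r)) sum ⟨
        + 4 ℤ.* e ℤ.- + 4 ℤ.* (p ℤ.* r ℤ.+ r ℤ.* r)
          ≡⟨ solve 3 (λ p r e → con (+ 4) :* e :- con (+ 4) :* (p :* r :+ r :* r) :=
               (e :- p :* r :- r :* r) :* con (+ 2) :* con (+ 2)) refl p r e ⟩
        (e ℤ.- p ℤ.* r ℤ.- r ℤ.* r) ℤ.* + 2 ℤ.* + 2 ∎))))
    (ℤ∣.∣m⇒∣m*n r ℤ∣.∣-refl)
  where open ℤSolver

-- The equation is u² - Qu + P³ = 0 with Q = 27l and P = 3k. Descent in place of valuations: 3
-- divides u = 3v, then v² = 3(3lv - k³) makes 3 divide v = 3w, and k³ = 3(3lw - w²) remains.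
3∣-descent : ∀ k l u → u ℤ.* u ≡ + 27 ℤ.* (l ℤ.* u ℤ.- k ℤ.* k ℤ.* k) → + 3 ∣ℤ k
3∣-descent k l u e with prime∣square prime[3] u
  (divides (+ 9 ℤ.* (l ℤ.* u ℤ.- k ℤ.* k ℤ.* k)) (trans e
    (solve 1 (λ x → con (+ 27) :* x := con (+ 9) :* x :* con (+ 3)) refl (l ℤ.* u ℤ.- k ℤ.* k ℤ.* k))))
  where open ℤSolver
... | divides v refl with prime∣square prime[3] v (divides (+ 3 ℤ.* (l ℤ.* v) ℤ.- k ℤ.* k ℤ.* k)
  (ℤP.*-cancelʳ-≡ _ _ (+ 9) (begin
    v ℤ.* v ℤ.* + 9
      ≡⟨ solve 1 (λ v → v :* v :* con (+ 9) := v :* con (+ 3) :* (v :* con (+ 3))) refl v ⟩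
    v ℤ.* + 3 ℤ.* (v ℤ.* + 3)
      ≡⟨ e ⟩
    + 27 ℤ.* (l ℤ.* (v ℤ.* + 3) ℤ.- k ℤ.* k ℤ.* k)
      ≡⟨ solve 3 (λ k l v → con (+ 27) :* (l :* (v :* con (+ 3)) :- k :* k :* k) :=
           (con (+ 3) :* (l :* v) :- k :* k :* k) :* con (+ 3) :* con (+ 9)) refl k l v ⟩
    (+ 3 ℤ.* (l ℤ.* v) ℤ.- k ℤ.* k ℤ.* k) ℤ.* + 3 ℤ.* + 9 ∎)))
  where open ℤSolver
... | divides w refl = prime∣cube prime[3] k (divides (+ 3 ℤ.* (l ℤ.* w) ℤ.- w ℤ.* w)
  (ℤP.*-cancelʳ-≡ _ _ (+ 27) (begin
    k ℤ.* k ℤ.* k ℤ.* + 27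
      ≡⟨ solve 3 (λ k l w → k :* k :* k :* con (+ 27) :=
           con (+ 27) :* (l :* (w :* con (+ 3) :* con (+ 3)))
           :- con (+ 27) :* (l :* (w :* con (+ 3) :* con (+ 3)) :- k :* k :* k)) refl k l w ⟩
    + 27 ℤ.* (l ℤ.* u′) ℤ.- + 27 ℤ.* (l ℤ.* u′ ℤ.- k ℤ.* k ℤ.* k)
      ≡⟨ cong (λ t → + 27 ℤ.* (l ℤ.* u′) ℤ.- t) e ⟨
    + 27 ℤ.* (l ℤ.* u′) ℤ.- u′ ℤ.* u′
      ≡⟨ solve 2 (λ l w →
           con (+ 27) :* (l :* (w :* con (+ 3) :* con (+ 3)))
             :- w :* con (+ 3) :* con (+ 3) :* (w :* con (+ 3) :* con (+ 3)) :=
           (con (+ 3) :* (l :* w) :- w :* w) :* con (+ 3) :* con (+ 27)) refl l w ⟩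
    (+ 3 ℤ.* (l ℤ.* w) ℤ.- w ℤ.* w) ℤ.* + 3 ℤ.* + 27 ∎)))
  where
  open ℤSolver
  u′ = w ℤ.* + 3 ℤ.* + 3

-- The resolvent of a monic cubic, and divisibility of its values by 3 and 2.

-- For F = x³ - T x² + S x - N and y = 3x - T, 27 F(x) = y³ - 3P y - Q; its roots are
-- y = s + t with st = P, where s³ and t³ are the roots of u² - Q u + P³.
module Depressed (T S N : ℤ) where

  P Q : ℤ
  P = T ℤ.* T ℤ.- + 3 ℤ.* S
  Q = + 27 ℤ.* N ℤ.+ + 2 ℤ.* (T ℤ.* T ℤ.* T) ℤ.- + 9 ℤ.* (T ℤ.* S)

  IsResolventRoot : ℤ → Set
  IsResolventRoot u = u ℤ.* u ℤ.+ ℤ.- Q ℤ.* u ℤ.+ P ℤ.* P ℤ.* P ≡ + 0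

open Depressed

-- The Horner form to which `evaluate` unfolds on the list -N, S, -T, 1; the final `x ℤ.* + 0` is
-- kept so that the two agree by computation.
charPolyAt : ℤ → ℤ → ℤ → ℤ → ℤ
charPolyAt T S N x = ℤ.- N ℤ.+ x ℤ.* (S ℤ.+ x ℤ.* (ℤ.- T ℤ.+ x ℤ.* (+ 1 ℤ.+ x ℤ.* + 0)))

charPolyAtExpr : ∀ {n} (T S N x : ℤSolver.Polynomial n) → ℤSolver.Polynomial n
charPolyAtExpr T S N x = :- N :+ x :* (S :+ x :* (:- T :+ x :* (con (+ 1) :+ x :* con (+ 0))))
  where open ℤSolver

∤1+multiple : ∀ {n} x → ¬ (+ (2 ℕ.+ n) ∣ℤ + 1 ℤ.+ x ℤ.* + (2 ℕ.+ n))
∤1+multiple {n} x n∣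
  with () ← ∣1⇒≡1 (ℤ∣.∣⇒∣ᵤ (ℤ∣.∣m+n∣n⇒∣m {+ (2 ℕ.+ n)} {+ 1} n∣ (ℤ∣.∣n⇒∣m*n x ℤ∣.∣-refl)))

-- Modulo 3 the cubic must be x³ - x: F(1) + F(-1) - 2F(0) = -2T and F(1) - F(-1) = 2 + 2S give T ≡
-- 0 and S ≡ -1.
3∤-values : ∀ T S N u → IsResolventRoot T S N u →
            + 3 ∣ℤ charPolyAt T S N (+ 1) → + 3 ∣ℤ charPolyAt T S N (ℤ.- + 1) →
            + 3 ∣ℤ charPolyAt T S N (+ 0) → ⊥
3∤-values T S N u root (divides α A) (divides β B) (divides γ C) =
  reduced (T ℤ.+ α ℤ.+ β ℤ.- + 2 ℤ.* γ) (S ℤ.+ + 1 ℤ.- α ℤ.+ β) T S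
    (begin
      T
        ≡⟨ solve 3 (λ T S N → T := con (+ 3) :* T :+ F T S N (con (+ 1)) :+ F T S N (:- con (+ 1))
                                     :- con (+ 2) :* F T S N (con (+ 0))) refl T S N ⟩
      + 3 ℤ.* T ℤ.+ charPolyAt T S N (+ 1) ℤ.+ charPolyAt T S N (ℤ.- + 1) ℤ.- + 2 ℤ.* charPolyAt T S N (+ 0)
        ≡⟨ cong₂ (λ a (b , c) → + 3 ℤ.* T ℤ.+ a ℤ.+ b ℤ.- + 2 ℤ.* c) A (cong₂ _,_ B C) ⟩
      + 3 ℤ.* T ℤ.+ α ℤ.* + 3 ℤ.+ β ℤ.* + 3 ℤ.- + 2 ℤ.* (γ ℤ.* + 3)
        ≡⟨ solve 4 (λ T a b c → con (+ 3) :* T :+ a :* con (+ 3) :+ b :* con (+ 3) :- con (+ 2) :* (c :* con (+ 3))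
                       := (T :+ a :+ b :- con (+ 2) :* c) :* con (+ 3)) refl T α β γ ⟩
      (T ℤ.+ α ℤ.+ β ℤ.- + 2 ℤ.* γ) ℤ.* + 3 ∎)
    (begin
      S
        ≡⟨ solve 3 (λ T S N → S := con (+ 3) :* S :+ con (+ 2) :- F T S N (con (+ 1)) :+ F T S N (:- con (+ 1)))
                    refl T S N ⟩
      + 3 ℤ.* S ℤ.+ + 2 ℤ.- charPolyAt T S N (+ 1) ℤ.+ charPolyAt T S N (ℤ.- + 1)
        ≡⟨ cong₂ (λ a b → + 3 ℤ.* S ℤ.+ + 2 ℤ.- a ℤ.+ b) A B ⟩
      + 3 ℤ.* S ℤ.+ + 2 ℤ.- α ℤ.* + 3 ℤ.+ β ℤ.* + 3
        ≡⟨ solve 3 (λ S a b → con (+ 3) :* S :+ con (+ 2) :- a :* con (+ 3) :+ b :* con (+ 3)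
                       := (S :+ con (+ 1) :- a :+ b) :* con (+ 3) :- con (+ 1)) refl S α β ⟩
      (S ℤ.+ + 1 ℤ.- α ℤ.+ β) ℤ.* + 3 ℤ.- + 1 ∎)
    root
  where
  open ℤSolver
  F = charPolyAtExpr

  -- With T = 3t and S = 3s - 1 one has P = 3k for k = 1 + 3(t² - s), and Q = 27l for l = N + 2t³ -
  -- tS. The descent then makes 3 divide k, which is 1 modulo 3.
  reduced : ∀ t s T S → T ≡ t ℤ.* + 3 → S ≡ s ℤ.* + 3 ℤ.- + 1 → IsResolventRoot T S N u → ⊥
  reduced t s T S refl refl root = ∤1+multiple (t ℤ.* t ℤ.- s)
    (3∣-descent (+ 1 ℤ.+ (t ℤ.* t ℤ.- s) ℤ.* + 3 ) (N ℤ.+ + 2 ℤ.* (t ℤ.* t ℤ.* t) ℤ.- t ℤ.* S) u (begin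
      u ℤ.* u
        ≡⟨ ℤP.+-identityʳ (u ℤ.* u) ⟨
      u ℤ.* u ℤ.- + 0
        ≡⟨ cong (λ x → u ℤ.* u ℤ.- x) root ⟨
      u ℤ.* u ℤ.- (u ℤ.* u ℤ.+ ℤ.- Q T S N ℤ.* u ℤ.+ P T S N ℤ.* P T S N ℤ.* P T S N)
        ≡⟨ solve 4 (λ t s N u →
             let T = t :* con (+ 3)
                 S = s :* con (+ 3) :- con (+ 1)
                 P = T :* T :- con (+ 3) :* S
                 Q = con (+ 27) :* N :+ con (+ 2) :* (T :* T :* T) :- con (+ 9) :* (T :* S)
                 k = con (+ 1) :+ (t :* t :- s) :* con (+ 3)
             in u :* u :- (u :* u :+ :- Q :* u :+ P :* P :* P) :=
                con (+ 27) :* ((N :+ con (+ 2) :* (t :* t :* t) :- t :* S) :* u :- k :* k :* k))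
             refl t s N u ⟩
      _ ∎))

2∣n²+n : ∀ n → + 2 ∣ℤ + n ℤ.* + n ℤ.+ + n
2∣n²+n zero    = divides (+ 0) refl
2∣n²+n (suc n) with divides h e ← 2∣n²+n n = divides (h ℤ.+ (+ 1 ℤ.+ + n)) (begin
    (+ 1 ℤ.+ + n) ℤ.* (+ 1 ℤ.+ + n) ℤ.+ (+ 1 ℤ.+ + n)
      ≡⟨ solve 1 (λ n → (con (+ 1) :+ n) :* (con (+ 1) :+ n) :+ (con (+ 1) :+ n) :=
                        n :* n :+ n :+ (con (+ 1) :+ n) :* con (+ 2)) refl (+ n) ⟩
    + n ℤ.* + n ℤ.+ + n ℤ.+ (+ 1 ℤ.+ + n) ℤ.* + 2
      ≡⟨ cong (ℤ._+ (+ 1 ℤ.+ + n) ℤ.* + 2) e ⟩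
    h ℤ.* + 2 ℤ.+ (+ 1 ℤ.+ + n) ℤ.* + 2
      ≡⟨ ℤP.*-distribʳ-+ (+ 2) h (+ 1 ℤ.+ + n) ⟨
    (h ℤ.+ (+ 1 ℤ.+ + n)) ℤ.* + 2 ∎)
  where open ℤSolver

2∣x²+x : ∀ x → + 2 ∣ℤ x ℤ.* x ℤ.+ x
2∣x²+x (+ n)    = 2∣n²+n n
2∣x²+x -[1+ n ] with divides h e ← 2∣n²+n n = divides h (trans
  (solve 1 (λ n → :- (con (+ 1) :+ n) :* :- (con (+ 1) :+ n) :+ :- (con (+ 1) :+ n) := n :* n :+ n) refl (+ n)) e)
  where open ℤSolver

6∣n³-n : ∀ n → + 6 ∣ℤ + n ℤ.* + n ℤ.* + n ℤ.- + n
6∣n³-n zero    = divides (+ 0) refl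
6∣n³-n (suc n) with divides h e ← 2∣n²+n n | divides k f ← 6∣n³-n n = divides (k ℤ.+ h) (begin
    (+ 1 ℤ.+ + n) ℤ.* (+ 1 ℤ.+ + n) ℤ.* (+ 1 ℤ.+ + n) ℤ.- (+ 1 ℤ.+ + n)
      ≡⟨ solve 1 (λ n → (con (+ 1) :+ n) :* (con (+ 1) :+ n) :* (con (+ 1) :+ n) :- (con (+ 1) :+ n) :=
                        n :* n :* n :- n :+ con (+ 3) :* (n :* n :+ n)) refl (+ n) ⟩
    + n ℤ.* + n ℤ.* + n ℤ.- + n ℤ.+ + 3 ℤ.* (+ n ℤ.* + n ℤ.+ + n)
      ≡⟨ cong₂ (λ a b → a ℤ.+ + 3 ℤ.* b) f e ⟩
    k ℤ.* + 6 ℤ.+ + 3 ℤ.* (h ℤ.* + 2)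
      ≡⟨ solve 2 (λ k h → k :* con (+ 6) :+ con (+ 3) :* (h :* con (+ 2)) := (k :+ h) :* con (+ 6)) refl k h ⟩
    (k ℤ.+ h) ℤ.* + 6 ∎)
  where open ℤSolver

6∣x³-x : ∀ x → + 6 ∣ℤ x ℤ.* x ℤ.* x ℤ.- x
6∣x³-x (+ n)    = 6∣n³-n n
6∣x³-x -[1+ n ] with divides k f ← 6∣n³-n (suc n) = divides (ℤ.- k) (begin
    ℤ.- x ℤ.* ℤ.- x ℤ.* ℤ.- x ℤ.- ℤ.- x
      ≡⟨ solve 1 (λ x → :- x :* :- x :* :- x :- :- x := :- (x :* x :* x :- x)) refl x ⟩
    ℤ.- (x ℤ.* x ℤ.* x ℤ.- x)  ≡⟨ cong ℤ.-_ f ⟩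
    ℤ.- (k ℤ.* + 6)            ≡⟨ ℤP.neg-distribˡ-* k (+ 6) ⟩
    ℤ.- k ℤ.* + 6              ∎)
  where
  open ℤSolver
  x = + suc n

-- Evenness of F(0) and F(1) makes N even and S ≡ T + 1 modulo 2, so P = T² - 3S is odd. But P³ = (Q
-- - u)u, which would be even if u were.
2∤-resolventRoot : ∀ T S N u → IsResolventRoot T S N u →
                   + 2 ∣ℤ charPolyAt T S N (+ 1) → + 2 ∣ℤ charPolyAt T S N (+ 0) → ¬ (+ 2 ∣ℤ u)
2∤-resolventRoot T S N u root (divides α A) (divides γ C) 2∣u
  = ∤1+multiple r (subst (+ 2 ∣ℤ_) P≡1+r*2 (prime∣cube prime[2] P′ 2∣P³))
  where
  open ℤSolver
  F = charPolyAtExpr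
  P′ = P T S N
  Q′ = Q T S N
  h′ = ℤ∣._∣_.quotient (2∣x²+x T)
  r = h′ ℤ.- T ℤ.- T ℤ.+ + 1 ℤ.- + 3 ℤ.* α ℤ.+ + 3 ℤ.* γ

  2∣P³ : + 2 ∣ℤ P′ ℤ.* P′ ℤ.* P′
  2∣P³ = subst (+ 2 ∣ℤ_) (begin
    (Q′ ℤ.- u) ℤ.* u
      ≡⟨ solve 3 (λ Q p u → (Q :- u) :* u := p :- (u :* u :+ :- Q :* u :+ p)) refl Q′ (P′ ℤ.* P′ ℤ.* P′) u ⟩
    P′ ℤ.* P′ ℤ.* P′ ℤ.- (u ℤ.* u ℤ.+ ℤ.- Q′ ℤ.* u ℤ.+ P′ ℤ.* P′ ℤ.* P′)
      ≡⟨ cong (λ t → P′ ℤ.* P′ ℤ.* P′ ℤ.- t) root ⟩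
    P′ ℤ.* P′ ℤ.* P′ ℤ.- + 0
      ≡⟨ ℤP.+-identityʳ _ ⟩
    P′ ℤ.* P′ ℤ.* P′ ∎) (ℤ∣.∣n⇒∣m*n (Q′ ℤ.- u) 2∣u)

  P≡1+r*2 : P′ ≡ + 1 ℤ.+ r ℤ.* + 2
  P≡1+r*2 = begin
    P′
      ≡⟨ solve 3 (λ T S N →
           T :* T :- con (+ 3) :* S :=
           T :* T :+ T :- con (+ 4) :* T :+ con (+ 3) :- con (+ 3) :* F T S N (con (+ 1))
             :+ con (+ 3) :* F T S N (con (+ 0))) refl T S N ⟩
    T ℤ.* T ℤ.+ T ℤ.- + 4 ℤ.* T ℤ.+ + 3 ℤ.- + 3 ℤ.* charPolyAt T S N (+ 1) ℤ.+ + 3 ℤ.* charPolyAt T S N (+ 0)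
      ≡⟨ cong₂ (λ a (b , c) → a ℤ.- + 4 ℤ.* T ℤ.+ + 3 ℤ.- + 3 ℤ.* b ℤ.+ + 3 ℤ.* c)
               (ℤ∣._∣_.equality (2∣x²+x T)) (cong₂ _,_ A C) ⟩
    h′ ℤ.* + 2 ℤ.- + 4 ℤ.* T ℤ.+ + 3 ℤ.- + 3 ℤ.* (α ℤ.* + 2) ℤ.+ + 3 ℤ.* (γ ℤ.* + 2)
      ≡⟨ solve 4 (λ T h a c →
           h :* con (+ 2) :- con (+ 4) :* T :+ con (+ 3) :- con (+ 3) :* (a :* con (+ 2)) :+ con (+ 3) :* (c :* con (+ 2)) :=
           con (+ 1) :+ (h :- T :- T :+ con (+ 1) :- con (+ 3) :* a :+ con (+ 3) :* c) :* con (+ 2))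
         refl T h′ α γ ⟩
    + 1 ℤ.+ r ℤ.* + 2 ∎

-- The 2-adic valuation of d (n/m)³ is that of d modulo 3, hence not zero.
even-cube-multiple : ∀ d n u m → Coprime m ℤ.∣ n ∣ → d ℤ.* (n ℤ.* n ℤ.* n) ≡ u ℤ.* (+ m ℤ.* + m ℤ.* + m) →
                     2 ∣ℕ ℤ.∣ d ∣ → ¬ (8 ∣ℕ ℤ.∣ d ∣) → + 2 ∣ℤ u
even-cube-multiple d n u m m⊥n e 2∣d 8∤d
  with euclidsLemma ℤ.∣ u ∣ ℤ.∣ m³ ∣ prime[2]
         (subst (2 ∣ℕ_) (trans (sym (ℤP.abs-* d n³)) (trans (cong ℤ.∣_∣ e) (ℤP.abs-* u m³)))
           (∣m⇒∣m*n ℤ.∣ n³ ∣ 2∣d))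
  where
  n³ = n ℤ.* n ℤ.* n
  m³ = + m ℤ.* + m ℤ.* + m
... | inj₁ 2∣u = ℤ∣.∣ᵤ⇒∣ 2∣u
... | inj₂ 2∣m³ with prime∣cube prime[2] (+ m) (ℤ∣.∣ᵤ⇒∣ 2∣m³)
-- An even denominator m makes n odd and 8 a divisor of m³, hence of n³d, hence of d.
... | divides k m≡k*2 = ⊥-elim (8∤d (coprime-divisor′ 8⊥n 8∣n³d))
  where
  open ℤSolver
  8⊥n : Coprime 8 ℤ.∣ n ∣
  8⊥n = coprime-^ 3 λ (i∣2 , i∣n) → m⊥n (∣-trans i∣2 (ℤ∣.∣⇒∣ᵤ (divides k m≡k*2)) , i∣n)

  8∣n³d : 8 ∣ℕ ℤ.∣ n ∣ ℕ.* (ℤ.∣ n ∣ ℕ.* (ℤ.∣ n ∣ ℕ.* ℤ.∣ d ∣))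
  8∣n³d = subst (8 ∣ℕ_)
    (trans (ℤP.abs-* n _) (cong (ℤ.∣ n ∣ ℕ.*_) (trans (ℤP.abs-* n _) (cong (ℤ.∣ n ∣ ℕ.*_) (ℤP.abs-* n d)))))
    (ℤ∣.∣⇒∣ᵤ (divides {+ 8} (u ℤ.* (k ℤ.* k ℤ.* k)) (begin
      n ℤ.* (n ℤ.* (n ℤ.* d))           ≡⟨ solve 2 (λ n d → n :* (n :* (n :* d)) := d :* (n :* n :* n)) refl n d ⟩
      d ℤ.* (n ℤ.* n ℤ.* n)             ≡⟨ e ⟩
      u ℤ.* (+ m ℤ.* + m ℤ.* + m)       ≡⟨ cong (λ t → u ℤ.* (t ℤ.* t ℤ.* t)) m≡k*2 ⟩
      u ℤ.* (k ℤ.* + 2 ℤ.* (k ℤ.* + 2) ℤ.* (k ℤ.* + 2))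
        ≡⟨ solve 2 (λ u k → u :* (k :* con (+ 2) :* (k :* con (+ 2)) :* (k :* con (+ 2))) := u :* (k :* k :* k) :* con (+ 8))
             refl u k ⟩
      u ℤ.* (k ℤ.* k ℤ.* k) ℤ.* + 8     ∎)))

  coprime-divisor′ : ∀ {i n o} → Coprime i n → i ∣ℕ n ℕ.* (n ℕ.* (n ℕ.* o)) → i ∣ℕ o
  coprime-divisor′ c i∣ = Coprimality.coprime-divisor c (Coprimality.coprime-divisor c (Coprimality.coprime-divisor c i∣))

-- The values of x³ - t x² + s x - n at 0 and ±1 only show that 2t and 2s are integers;
-- the last hypothesis settles the parity.
integral-coefficients : ∀ t s n → IsInteger n → IsInteger (1ℚ ℚ.- t ℚ.+ s ℚ.- n) → IsInteger (1ℚ ℚ.+ t ℚ.+ s ℚ.+ n) →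
                        IsInteger ((t ℚ.- n) ℚ.* (t ℚ.- n) ℚ.+ (s ℚ.- 1ℚ) ℚ.* (s ℚ.- 1ℚ)) →
                        IsInteger t × IsInteger s
integral-coefficients t s _ (n , refl) (f , f-eq) (g , g-eq) (e , e-eq)
  = t∈ℤ , s∈ℤ
    where
    open ℤSolver
    -- Here g - f - 4n = 2(t - n) and f + g - 4 = 2(s - 1). These integers have the same parity and
    -- their squares add up to 4e, so both are even and s - 1 is an integer.
    squares : ℤ→ℚ (+ 4) ℚ.* ℤ→ℚ e ≡
      (ℤ→ℚ g ℚ.- ℤ→ℚ f ℚ.- ℤ→ℚ (+ 4) ℚ.* ℤ→ℚ n) ℚ.* (ℤ→ℚ g ℚ.- ℤ→ℚ f ℚ.- ℤ→ℚ (+ 4) ℚ.* ℤ→ℚ n)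
      ℚ.+ (ℤ→ℚ f ℚ.+ ℤ→ℚ g ℚ.- ℤ→ℚ (+ 4)) ℚ.* (ℤ→ℚ f ℚ.+ ℤ→ℚ g ℚ.- ℤ→ℚ (+ 4))
    squares rewrite sym e-eq | sym f-eq | sym g-eq = Q.solve 3 (λ t s n →
      let f = Q.con 1ℚ Q.:- t Q.:+ s Q.:- n
          g = Q.con 1ℚ Q.:+ t Q.:+ s Q.:+ n
          p = g Q.:- f Q.:- Q.con (ℤ→ℚ (+ 4)) Q.:* n
          q = f Q.:+ g Q.:- Q.con (ℤ→ℚ (+ 4))
      in Q.con (ℤ→ℚ (+ 4)) Q.:* ((t Q.:- n) Q.:* (t Q.:- n) Q.:+ (s Q.:- Q.con 1ℚ) Q.:* (s Q.:- Q.con 1ℚ))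
         Q.:= p Q.:* p Q.:+ q Q.:* q) refl t s (ℤ→ℚ n)

    even : + 2 ∣ℤ f ℤ.+ g ℤ.- + 4
    even = sum-of-squares-even (g ℤ.- f ℤ.- + 4 ℤ.* n) (f ℤ.+ g ℤ.- + 4) (f ℤ.- + 2 ℤ.+ + 2 ℤ.* n) e
      (ℚ⇒ℤ (con (+ 4) :* var 3F)
           ((var 2F :- var 1F :- con (+ 4) :* var 0F) :* (var 2F :- var 1F :- con (+ 4) :* var 0F)
            :+ (var 1F :+ var 2F :- con (+ 4)) :* (var 1F :+ var 2F :- con (+ 4)))
           (n Vec.∷ f Vec.∷ g Vec.∷ e Vec.∷ Vec.[])
           squares)
      (ℤSolver.solve 3 (λ n f g → f :+ g :- con (+ 4) := g :- f :- con (+ 4) :* n :+ con (+ 2) :* (f :- con (+ 2) :+ con (+ 2) :* n))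
        refl n f g)

    h = _∣ℤ_.quotient even
    h-eq = _∣ℤ_.equality even

    s≡h+1 : s ≡ ℤ→ℚ h ℚ.+ 1ℚ
    s≡h+1 = begin
      s
        ≡⟨ Q.solve 3 (λ t s n → s Q.:= Q.con ℚ.½ Q.:* ((Q.con 1ℚ Q.:- t Q.:+ s Q.:- n)
             Q.:+ (Q.con 1ℚ Q.:+ t Q.:+ s Q.:+ n) Q.:- Q.con (ℤ→ℚ (+ 4))) Q.:+ Q.con 1ℚ) refl t s (ℤ→ℚ n) ⟩
      ℚ.½ ℚ.* ((1ℚ ℚ.- t ℚ.+ s ℚ.- ℤ→ℚ n) ℚ.+ (1ℚ ℚ.+ t ℚ.+ s ℚ.+ ℤ→ℚ n) ℚ.- ℤ→ℚ (+ 4)) ℚ.+ 1ℚ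
        ≡⟨ cong₂ (λ f g → ℚ.½ ℚ.* (f ℚ.+ g ℚ.- ℤ→ℚ (+ 4)) ℚ.+ 1ℚ) f-eq g-eq ⟩
      ℚ.½ ℚ.* (ℤ→ℚ f ℚ.+ ℤ→ℚ g ℚ.- ℤ→ℚ (+ 4)) ℚ.+ 1ℚ
        ≡⟨ cong (λ t → ℚ.½ ℚ.* t ℚ.+ 1ℚ) (ℤ→ℚ-⟦⟧ (var 0F :+ var 1F :- con (+ 4)) (f Vec.∷ g Vec.∷ Vec.[])) ⟨
      ℚ.½ ℚ.* ℤ→ℚ (f ℤ.+ g ℤ.- + 4) ℚ.+ 1ℚ
        ≡⟨ cong (λ t → ℚ.½ ℚ.* t ℚ.+ 1ℚ) (trans (cong ℤ→ℚ h-eq) (ℤ→ℚ-* h (+ 2))) ⟩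
      ℚ.½ ℚ.* (ℤ→ℚ h ℚ.* ℤ→ℚ (+ 2)) ℚ.+ 1ℚ
        ≡⟨ Q.solve 1 (λ h → Q.con ℚ.½ Q.:* (h Q.:* Q.con (ℤ→ℚ (+ 2))) Q.:+ Q.con 1ℚ Q.:= h Q.:+ Q.con 1ℚ) refl (ℤ→ℚ h) ⟩
      ℤ→ℚ h ℚ.+ 1ℚ ∎

    s∈ℤ : IsInteger s
    s∈ℤ = h ℤ.+ + 1 , trans s≡h+1 (sym (ℤ→ℚ-+ h (+ 1)))

    t∈ℤ : IsInteger t
    t∈ℤ = subst IsInteger
      (Q.solve 3 (λ t s n → s Q.:+ Q.con 1ℚ Q.:- n Q.:- (Q.con 1ℚ Q.:- t Q.:+ s Q.:- n) Q.:= t) refl t s (ℤ→ℚ n))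
      (+-isInteger (+-isInteger (+-isInteger s∈ℤ (+ 1 , refl)) (neg-isInteger (n , refl))) (neg-isInteger (f , f-eq)))

-- The gcd of all values of a monic cubic polynomial.

indexOf : ℤ → ℤ → ℤ → ℕ
indexOf T S N =
  gcd (gcd ℤ.∣ charPolyAt T S N (+ 1) ∣ ℤ.∣ charPolyAt T S N (ℤ.- + 1) ∣) (gcd ℤ.∣ charPolyAt T S N (+ 0) ∣ 6)

module _ (T S N : ℤ) where
  private
    F = charPolyAt T S N
    g = indexOf T S N

  index∣F[1] : + g ∣ℤ F (+ 1)
  index∣F[1] = ℤ∣.∣ᵤ⇒∣ (∣-trans (gcd[m,n]∣m (gcd ℤ.∣ F (+ 1) ∣ _) _) (gcd[m,n]∣m ℤ.∣ F (+ 1) ∣ _))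

  index∣F[-1] : + g ∣ℤ F (ℤ.- + 1)
  index∣F[-1] = ℤ∣.∣ᵤ⇒∣ (∣-trans (gcd[m,n]∣m (gcd ℤ.∣ F (+ 1) ∣ _) _) (gcd[m,n]∣n ℤ.∣ F (+ 1) ∣ _))

  index∣F[0] : + g ∣ℤ F (+ 0)
  index∣F[0] = ℤ∣.∣ᵤ⇒∣ (∣-trans (gcd[m,n]∣n (gcd ℤ.∣ F (+ 1) ∣ _) _) (gcd[m,n]∣m ℤ.∣ F (+ 0) ∣ 6))

  index∣6 : g ∣ℕ 6
  index∣6 = ∣-trans (gcd[m,n]∣n (gcd ℤ.∣ F (+ 1) ∣ _) _) (gcd[m,n]∣n ℤ.∣ F (+ 0) ∣ 6)

  ∣index : ∀ {h} → + h ∣ℤ F (+ 1) → + h ∣ℤ F (ℤ.- + 1) → + h ∣ℤ F (+ 0) → h ∣ℕ 6 → h ∣ℕ g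
  ∣index h∣A h∣B h∣C h∣6 = gcd-greatest (gcd-greatest (ℤ∣.∣⇒∣ᵤ h∣A) (ℤ∣.∣⇒∣ᵤ h∣B)) (gcd-greatest (ℤ∣.∣⇒∣ᵤ h∣C) h∣6)

  -- F(x) = (x³ - x) + F(0) (1 - x²) + F(1) (x² + x)/2 + F(-1) (x² - x)/2.
  interpolation : ∀ x h k → x ℤ.* x ℤ.+ x ≡ h ℤ.* + 2 → x ℤ.* x ℤ.* x ℤ.- x ≡ k ℤ.* + 6 →
    F x ≡ k ℤ.* + 6 ℤ.+ (+ 1 ℤ.- x ℤ.* x) ℤ.* F (+ 0) ℤ.+ h ℤ.* F (+ 1) ℤ.+ (h ℤ.- x) ℤ.* F (ℤ.- + 1)
  interpolation x h k h-eq k-eq = begin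
    F x
      ≡⟨ solve 4 (λ T S N x → E T S N x :=
           (x :* x :* x :- x) :+ (con (+ 1) :- x :* x) :* E T S N (con (+ 0))
           :- (T :+ N) :* (x :* x :+ x) :- x :* E T S N (:- con (+ 1))) refl T S N x ⟩
    (x ℤ.* x ℤ.* x ℤ.- x) ℤ.+ (+ 1 ℤ.- x ℤ.* x) ℤ.* F (+ 0) ℤ.- (T ℤ.+ N) ℤ.* (x ℤ.* x ℤ.+ x) ℤ.- x ℤ.* F (ℤ.- + 1)
      ≡⟨ cong₂ (λ a b → b ℤ.+ (+ 1 ℤ.- x ℤ.* x) ℤ.* F (+ 0) ℤ.- (T ℤ.+ N) ℤ.* a ℤ.- x ℤ.* F (ℤ.- + 1)) h-eq k-eq ⟩
    k ℤ.* + 6 ℤ.+ (+ 1 ℤ.- x ℤ.* x) ℤ.* F (+ 0) ℤ.- (T ℤ.+ N) ℤ.* (h ℤ.* + 2) ℤ.- x ℤ.* F (ℤ.- + 1)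
      ≡⟨ solve 6 (λ T S N x h k →
           k :* con (+ 6) :+ (con (+ 1) :- x :* x) :* E T S N (con (+ 0)) :- (T :+ N) :* (h :* con (+ 2)) :- x :* E T S N (:- con (+ 1)) :=
           k :* con (+ 6) :+ (con (+ 1) :- x :* x) :* E T S N (con (+ 0)) :+ h :* E T S N (con (+ 1)) :+ (h :- x) :* E T S N (:- con (+ 1)))
           refl T S N x h k ⟩
    _ ∎
    where
    open ℤSolver
    E = charPolyAtExpr

  -- Interpolation, with the integers h = (x² + x)/2 and k = (x³ - x)/6, writes each value as an
  -- integral combination of F(1), F(-1), F(0) and 6. Conversely 6 is a combination of values.
  index-isGcd : IsGcd (λ x → ℤ.∣ F x ∣) g
  index-isGcd = divides-all , greatest
    where
    divides-all : ∀ x → g ∣ℕ ℤ.∣ F x ∣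
    divides-all x with divides h h-eq ← 2∣x²+x x | divides k k-eq ← 6∣x³-x x =
      ℤ∣.∣⇒∣ᵤ (subst (+ g ∣ℤ_) (sym (interpolation x h k h-eq k-eq))
        (ℤ∣.∣m∣n⇒∣m+n (ℤ∣.∣m∣n⇒∣m+n (ℤ∣.∣m∣n⇒∣m+n
          (ℤ∣.∣n⇒∣m*n k (ℤ∣.∣ᵤ⇒∣ index∣6)) (ℤ∣.∣n⇒∣m*n (+ 1 ℤ.- x ℤ.* x) index∣F[0]))
          (ℤ∣.∣n⇒∣m*n h index∣F[1])) (ℤ∣.∣n⇒∣m*n (h ℤ.- x) index∣F[-1])))

    greatest : ∀ h → (∀ x → h ∣ℕ ℤ.∣ F x ∣) → h ∣ℕ g
    greatest h h∣F = ∣index (h∣ (+ 1)) (h∣ (ℤ.- + 1)) (h∣ (+ 0)) (ℤ∣.∣⇒∣ᵤ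
      (subst (+ h ∣ℤ_)
        -- The third difference F(2) - 3F(1) + 3F(0) - F(-1) of a monic cubic is 3! = 6.
        (solve 3 (λ T S N → E T S N (con (+ 2)) :+ con (+ 3) :* E T S N (con (+ 0)) :- con (+ 3) :* E T S N (con (+ 1))
                              :- E T S N (:- con (+ 1)) := con (+ 6)) refl T S N)
        (ℤ∣.∣m∣n⇒∣m-n (ℤ∣.∣m∣n⇒∣m-n (ℤ∣.∣m∣n⇒∣m+n (h∣ (+ 2)) (ℤ∣.∣n⇒∣m*n (+ 3) (h∣ (+ 0))))
          (ℤ∣.∣n⇒∣m*n (+ 3) (h∣ (+ 1)))) (h∣ (ℤ.- + 1)))))
      where
      open ℤSolver
      E = charPolyAtExpr
      h∣ : ∀ x → + h ∣ℤ F x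
      h∣ x = ℤ∣.∣ᵤ⇒∣ (h∣F x)

prime∤⇒coprime : ∀ {p n} → Prime p → ¬ (p ∣ℕ n) → Coprime n p
prime∤⇒coprime p-prime p∤n (i∣n , i∣p) with prime⇒irreducible p-prime i∣p
... | inj₁ i≡1  = i≡1
... | inj₂ refl = ⊥-elim (p∤n i∣n)

-- Multiplying by the cube of the denominator of β reduces this to `even-cube-multiple`.
rational-even-cube-multiple : ∀ d β u → ℤ→ℚ d ℚ.* (β ℚ.* β ℚ.* β) ≡ ℤ→ℚ u →
                              2 ∣ℕ ℤ.∣ d ∣ → ¬ (8 ∣ℕ ℤ.∣ d ∣) → + 2 ∣ℤ u
rational-even-cube-multiple d β u e = even-cube-multiple d n u m (↧-coprime-↥ β)
  (ℚ⇒ℤ (var 0F :* (var 1F :* var 1F :* var 1F)) (var 2F :* (var 3F :* var 3F :* var 3F))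
       (d Vec.∷ n Vec.∷ u Vec.∷ + m Vec.∷ Vec.[]) (begin
    ℤ→ℚ d ℚ.* (ℤ→ℚ n ℚ.* ℤ→ℚ n ℚ.* ℤ→ℚ n)
      ≡⟨ cong (λ t → ℤ→ℚ d ℚ.* (t ℚ.* t ℚ.* t)) (p*↧p≡↥p β) ⟨
    ℤ→ℚ d ℚ.* (β ℚ.* M ℚ.* (β ℚ.* M) ℚ.* (β ℚ.* M))
      ≡⟨ Q.solve 3 (λ D β M → D Q.:* (β Q.:* M Q.:* (β Q.:* M) Q.:* (β Q.:* M))
           Q.:= D Q.:* (β Q.:* β Q.:* β) Q.:* (M Q.:* M Q.:* M)) refl (ℤ→ℚ d) β M ⟩
    ℤ→ℚ d ℚ.* (β ℚ.* β ℚ.* β) ℚ.* (M ℚ.* M ℚ.* M)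
      ≡⟨ cong (ℚ._* (M ℚ.* M ℚ.* M)) e ⟩
    ℤ→ℚ u ℚ.* (M ℚ.* M ℚ.* M) ∎))
  where
  open ℤSolver
  n = ↥ β
  m = ↧ₙ β
  M = ℤ→ℚ (+ m)

-- The pure cubic field

-- The determinant of Defs, taken over the expressions of the ring solver, yields
-- expressions whose values are the coefficients of charPoly by computation.
module Symbolic where
  open ℚSolver using (_:+_; _:*_; _:-_; :-_; con) renaming (Polynomial to Expr)

  exprRing : ℕ → RawRing 0ℓ 0ℓ
  exprRing n = record
    { Carrier = Expr n ; _≈_ = _≡_ ; _+_ = _:+_ ; _*_ = _:*_ ; -_ = :-_
    ; 0# = con 0ℚ ; 1# = con 1ℚ }

  product : ∀ {n} → Expr n → (x y : Fin 3 → Expr n) → Fin 3 → Expr n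
  product D x y zero =
    x zero :* y zero :+ D :* (x (suc zero) :* y (suc (suc zero)) :+ x (suc (suc zero)) :* y (suc zero))
  product D x y (suc zero) =
    x zero :* y (suc zero) :+ x (suc zero) :* y zero :+ D :* (x (suc (suc zero)) :* y (suc (suc zero)))
  product D x y (suc (suc zero)) =
    x zero :* y (suc (suc zero)) :+ x (suc zero) :* y (suc zero) :+ x (suc (suc zero)) :* y zero

  triple : ∀ {A : Set} → A → A → A → Fin 3 → A
  triple a b c zero             = a
  triple a b c (suc zero)       = b
  triple a b c (suc (suc zero)) = c

  charPolyExpr : ∀ {n} (D a b c : Expr n) → List (Expr n)
  charPolyExpr {n} D a b c = Matrix.det rawRing λ i j →
      (if does (i ≟ᶠ j) then X else []) +ₚ map :-_ [ product D (triple a b c) (basis j) i ]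
    where
    open Polynomial (exprRing n)
    ∛D = triple (con 0ℚ) (con 1ℚ) (con 0ℚ)
    basis : Fin 3 → Fin 3 → Expr n
    basis = triple (triple (con 1ℚ) (con 0ℚ) (con 0ℚ)) ∛D (product D ∛D ∛D)

  coeffExpr : ∀ {n} → ℕ → (D a b c : Expr n) → Expr n
  coeffExpr k D a b c = Polynomial.coeff (exprRing _) (charPolyExpr D a b c) k

  -- The elementary symmetric functions of the three conjugates of a + b∛D + c∛D², of degrees 3, 2
  -- and 1.
  normExpr middleExpr traceExpr : ∀ {n} (D a b c : Expr n) → Expr n
  normExpr D a b c = a :* a :* a :+ D :* (b :* b :* b) :+ D :* D :* (c :* c :* c)
                     :- (con 1ℚ :+ con 1ℚ :+ con 1ℚ) :* D :* (a :* b :* c)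
  middleExpr D a b c = (con 1ℚ :+ con 1ℚ :+ con 1ℚ) :* (a :* a :- D :* (b :* c))
  traceExpr  D a b c = (con 1ℚ :+ con 1ℚ :+ con 1ℚ) :* a

module CubicField (d : ℤ) (d-not-cube : ¬ PerfectCube d) where
  open PureCubic d d-not-cube hiding (inverse)
  open NumberField numberField
    using (Integral; Primitive; PrimitiveInteger; ℚ⟨_⟩; IsElementIndex; IsFieldIndex; charPoly; ι;
           generator; rational; addition; negation; multiplication; inverse; respects)
  open Cubic
  open Symbolic

  cubicRing : CommutativeRing 0ℓ 0ℓ
  cubicRing = record { isCommutativeRing = isCommutativeRing }

  embed-homomorphism : ℚ.+-*-rawRing ACR.-Raw-AlmostCommutative⟶ ACR.fromCommutativeRing cubicRing
  embed-homomorphism = record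
    { ⟦_⟧ = embed ; +-homo = λ _ _ → refl ; *-homo = embed-* ; -‿homo = λ _ → refl
    ; 0-homo = refl ; 1-homo = refl }

  embed-≟ : ∀ p q → Maybe (embed p ≡ embed q)
  embed-≟ p q = Maybe.map (cong embed) (dec⇒maybe (p ℚP.≟ q))

  -- Here field elements are the atoms and rationals the coefficients, so identities need not be
  -- expanded into coordinates.
  module CubicSolver = RingSolver ℚ.+-*-rawRing (ACR.fromCommutativeRing cubicRing) embed-homomorphism embed-≟

  ext : ∀ {a b c x y z} → a ≡ x → b ≡ y → c ≡ z → ⟨ a , b , c ⟩ ≡ ⟨ x , y , z ⟩
  ext refl refl refl = refl

  norm-* : ∀ x y → norm (x *ᶜ y) ≡ norm x ℚ.* norm y
  norm-* ⟨ a , b , c ⟩ ⟨ x , y , z ⟩ = solve 7 (λ D a b c x y z →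
      normExpr D (a :* x :+ D :* (b :* z :+ c :* y)) (a :* y :+ b :* x :+ D :* (c :* z)) (a :* z :+ b :* y :+ c :* x)
      := normExpr D a b c :* normExpr D x y z)
    refl D a b c x y z
    where open ℚSolver

  open Exp (CommutativeRing.semiring cubicRing) using (_^_)
  open CommutativeRing cubicRing using (*-identityˡ; *-identityʳ; distribˡ)

  trace middle : Cubic → ℚ
  trace  ⟨ a , b , c ⟩ = (1ℚ ℚ.+ 1ℚ ℚ.+ 1ℚ) ℚ.* a
  middle ⟨ a , b , c ⟩ = (1ℚ ℚ.+ 1ℚ ℚ.+ 1ℚ) ℚ.* (a ℚ.* a ℚ.- D ℚ.* (b ℚ.* c))

  -- Integer coordinates and common denominators.

  IntegerCoords : Cubic → Set
  IntegerCoords ⟨ a , b , c ⟩ = IsInteger a × IsInteger b × IsInteger c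

  +-integerCoords : ∀ {x y} → IntegerCoords x → IntegerCoords y → IntegerCoords (x +ᶜ y)
  +-integerCoords (a , b , c) (x , y , z) = +-isInteger a x , +-isInteger b y , +-isInteger c z

  neg-integerCoords : ∀ {x} → IntegerCoords x → IntegerCoords (-ᶜ x)
  neg-integerCoords (a , b , c) = neg-isInteger a , neg-isInteger b , neg-isInteger c

  *-integerCoords : ∀ {x y} → IntegerCoords x → IntegerCoords y → IntegerCoords (x *ᶜ y)
  *-integerCoords (a , b , c) (x , y , z) =
      +-isInteger (*-isInteger a x) (*-isInteger D∈ℤ (+-isInteger (*-isInteger b z) (*-isInteger c y)))
    , +-isInteger (+-isInteger (*-isInteger a y) (*-isInteger b x)) (*-isInteger D∈ℤ (*-isInteger c z))
    , +-isInteger (+-isInteger (*-isInteger a z) (*-isInteger b y)) (*-isInteger c x)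
    where
    D∈ℤ : IsInteger D
    D∈ℤ = d , refl

  embed-integerCoords : ∀ k → IntegerCoords (embed (ℤ→ℚ k))
  embed-integerCoords k = (k , refl) , (+ 0 , refl) , (+ 0 , refl)

  norm-isInteger : ∀ {x} → IntegerCoords x → IsInteger (norm x)
  norm-isInteger (a , b , c) =
    +-isInteger (+-isInteger (+-isInteger (cube a) (*-isInteger D∈ℤ (cube b))) (*-isInteger (*-isInteger D∈ℤ D∈ℤ) (cube c)))
      (neg-isInteger (*-isInteger (*-isInteger (+ 3 , refl) D∈ℤ) (*-isInteger (*-isInteger a b) c)))
    where
    D∈ℤ : IsInteger D
    D∈ℤ = d , refl
    cube : ∀ {q} → IsInteger q → IsInteger (q ℚ.* q ℚ.* q)
    cube q = *-isInteger (*-isInteger q q) q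

  embed-scales : ∀ q x → embed q *ᶜ x ≡ ⟨ q ℚ.* c₀ x , q ℚ.* c₁ x , q ℚ.* c₂ x ⟩
  embed-scales q ⟨ x , y , z ⟩ = ext
    (solve 5 (λ D q x y z → q :* x :+ D :* (con 0ℚ :* z :+ con 0ℚ :* y) := q :* x) refl D q x y z)
    (solve 5 (λ D q x y z → q :* y :+ con 0ℚ :* x :+ D :* (con 0ℚ :* z) := q :* y) refl D q x y z)
    (solve 4 (λ q x y z → q :* z :+ con 0ℚ :* y :+ con 0ℚ :* x := q :* z) refl q x y z)
    where open ℚSolver

  scalar : ℕ → Cubic
  scalar m = embed (ℤ→ℚ (+ m))

  scalar-* : ∀ m n → scalar (m ℕ.* n) ≡ scalar m *ᶜ scalar n
  scalar-* m n = trans (cong embed (trans (cong ℤ→ℚ (ℤP.pos-* m n)) (ℤ→ℚ-* (+ m) (+ n))))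
    (embed-* (ℤ→ℚ (+ m)) (ℤ→ℚ (+ n)))

  -- A common denominator of the coordinates, not necessarily the least one.
  denominator : Cubic → ℕ
  denominator ⟨ a , b , c ⟩ = ↧ₙ a ℕ.* (↧ₙ b ℕ.* ↧ₙ c)

  denominator≢0 : ∀ x → ℕ.NonZero (denominator x)
  denominator≢0 ⟨ a , b , c ⟩ = ℕP.m*n≢0 (↧ₙ a) (↧ₙ b ℕ.* ↧ₙ c) {{_}} {{ℕP.m*n≢0 (↧ₙ b) (↧ₙ c)}}

  denominator-clears : ∀ x → IntegerCoords (scalar (denominator x) *ᶜ x)
  denominator-clears ⟨ a , b , c ⟩ = subst IntegerCoords (sym (embed-scales (ℤ→ℚ (+ m)) ⟨ a , b , c ⟩))
    ( clears a (↧ₙ b ℕ.* ↧ₙ c) refl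
    , clears b (↧ₙ a ℕ.* ↧ₙ c) (trans (sym (ℕP.*-assoc (↧ₙ a) (↧ₙ b) (↧ₙ c)))
        (trans (cong (ℕ._* ↧ₙ c) (ℕP.*-comm (↧ₙ a) (↧ₙ b))) (ℕP.*-assoc (↧ₙ b) (↧ₙ a) (↧ₙ c))))
    , clears c (↧ₙ a ℕ.* ↧ₙ b) (trans (sym (ℕP.*-assoc (↧ₙ a) (↧ₙ b) (↧ₙ c))) (ℕP.*-comm (↧ₙ a ℕ.* ↧ₙ b) (↧ₙ c))))
    where
    m = denominator ⟨ a , b , c ⟩
    clears : ∀ q k → m ≡ ↧ₙ q ℕ.* k → IsInteger (ℤ→ℚ (+ m) ℚ.* q)
    clears q k e = + k ℤ.* ↥ q , (begin
      ℤ→ℚ (+ m) ℚ.* q                       ≡⟨ cong (λ t → ℤ→ℚ t ℚ.* q) (trans (cong +_ e) (ℤP.pos-* (↧ₙ q) k)) ⟩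
      ℤ→ℚ (↧ q ℤ.* + k) ℚ.* q               ≡⟨ cong (ℚ._* q) (ℤ→ℚ-* (↧ q) (+ k)) ⟩
      ℤ→ℚ (↧ q) ℚ.* ℤ→ℚ (+ k) ℚ.* q         ≡⟨ solve 3 (λ m k q → m :* k :* q := k :* (q :* m)) refl (ℤ→ℚ (↧ q)) (ℤ→ℚ (+ k)) q ⟩
      ℤ→ℚ (+ k) ℚ.* (q ℚ.* ℤ→ℚ (↧ q))       ≡⟨ cong (ℤ→ℚ (+ k) ℚ.*_) (p*↧p≡↥p q) ⟩
      ℤ→ℚ (+ k) ℚ.* ℤ→ℚ (↥ q)               ≡⟨ ℤ→ℚ-* (+ k) (↥ q) ⟨
      ℤ→ℚ (+ k ℤ.* ↥ q)                     ∎)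
      where open ℚSolver

  -- Multiplication by θ preserves W, because the monic equation of θ expresses
  -- θⁿ⁺¹ x through the θⁱ x with i ≤ n; hence so does multiplication by ℤ[θ],
  -- and the powers of an element of ℤ[θ] have bounded denominators.
  module IntegralElement (θ : Cubic) (cs : List ℤ)
    (root : Polynomial.evaluate (CommutativeRing.rawRing cubicRing)
              (map (λ k → ι (ℤ→ℚ k)) (cs ++ [ + 1 ])) θ ≡ 0ᶜ) where

    n = length cs

    -- Clears the denominators of all θⁱ with i ≤ n at once; see `W-1`.
    M : Cubic
    M = scalar (denominator θ ℕ.^ n)

    V W : Cubic → Set
    V x = IntegerCoords (M *ᶜ x)
    W x = ∀ i → i ℕ.≤ n → V (θ ^ i *ᶜ x)

    V-+ : ∀ {x y} → V x → V y → V (x +ᶜ y)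
    V-+ {x} {y} p q = subst IntegerCoords (sym (distribˡ M x y)) (+-integerCoords p q)

    V-neg : ∀ {x} → V x → V (-ᶜ x)
    V-neg {x} p = subst IntegerCoords (solve 2 (λ m x → :- (m :* x) := m :* :- x) refl M x) (neg-integerCoords p)
      where open CubicSolver

    V-embed : ∀ k {x} → V x → V (embed (ℤ→ℚ k) *ᶜ x)
    V-embed k {x} p = subst IntegerCoords
      (solve 3 (λ k m x → k :* (m :* x) := m :* (k :* x)) refl (embed (ℤ→ℚ k)) M x)
      (*-integerCoords (embed-integerCoords k) p)
      where open CubicSolver

    evaluateMonic : List ℤ → Cubic
    evaluateMonic cs = Polynomial.evaluate (CommutativeRing.rawRing cubicRing)
      (map (λ k → ι (ℤ→ℚ k)) (cs ++ [ + 1 ])) θ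

    V-shift : ∀ i {x} → V (θ ^ suc i *ᶜ x) → V (θ ^ i *ᶜ (θ *ᶜ x))
    V-shift i {x} = subst V (solve 3 (λ t p x → t :* p :* x := p :* (t :* x)) refl θ (θ ^ i) x)
      where open CubicSolver

    -- Without its leading term, the monic polynomial at θ times x is a ℤ-combination of the θⁱx
    -- with i < `length cs`. The induction splits off the constant term and replaces x by θx.
    V-lowerTerms : ∀ cs x → (∀ i → i ℕ.< length cs → V (θ ^ i *ᶜ x)) →
                   V (evaluateMonic cs *ᶜ x +ᶜ -ᶜ (θ ^ length cs *ᶜ x))
    V-lowerTerms [] x _ = subst IntegerCoords
      (solve 3 (λ m t x → con 0ℚ := m :* ((con 1ℚ :+ t :* con 0ℚ) :* x :+ :- (con 1ℚ :* x))) refl M θ x)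
      (embed-integerCoords (+ 0))
      where open CubicSolver
    V-lowerTerms (c ∷ cs) x p = subst V
      (solve 5 (λ c t e p x → c :* x :+ (e :* (t :* x) :+ :- (p :* (t :* x))) := (c :+ t :* e) :* x :+ :- (t :* p :* x))
        refl (embed (ℤ→ℚ c)) θ (evaluateMonic cs) (θ ^ length cs) x)
      (V-+ (V-embed c (subst V (*-identityˡ x) (p 0 (s≤s z≤n))))
           (V-lowerTerms cs (θ *ᶜ x) λ i i<n → V-shift i {x} (p (suc i) (s≤s i<n))))
      where open CubicSolver

    Acts : Cubic → Set
    Acts z = ∀ x → W x → W (z *ᶜ x)

    acts-θ : Acts θ
    acts-θ x w i i≤n with ℕP.m≤n⇒m<n∨m≡n i≤n
    ... | inj₁ i<n  = V-shift i {x} (w (suc i) i<n)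
    -- For i = n the exponent n + 1 leaves the range of W. By `root` the lower terms applied to y =
    -- θx equal -θⁿy.
    ... | inj₂ refl = subst V (begin
        -ᶜ (evaluateMonic cs *ᶜ y +ᶜ -ᶜ z)   ≡⟨ cong (λ e → -ᶜ (e *ᶜ y +ᶜ -ᶜ z)) root ⟩
        -ᶜ (0ᶜ *ᶜ y +ᶜ -ᶜ z)                 ≡⟨ solve 2 (λ y z → :- (con 0ℚ :* y :+ :- z) := z) refl y z ⟩
        z                                    ∎)
      (V-neg {evaluateMonic cs *ᶜ y +ᶜ -ᶜ z} (V-lowerTerms cs y λ i i<n → V-shift i {x} (w (suc i) i<n)))
      where
      open CubicSolver
      y = θ *ᶜ x
      z = θ ^ n *ᶜ y

    acts-1 : Acts 1ᶜ
    acts-1 x w i i≤n = subst (λ y → V (θ ^ i *ᶜ y)) (sym (*-identityˡ x)) (w i i≤n)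

    acts-+ : ∀ y z → Acts y → Acts z → Acts (y +ᶜ z)
    acts-+ y z p q x w i i≤n = subst V
      (solve 4 (λ t y z x → t :* (y :* x) :+ t :* (z :* x) := t :* ((y :+ z) :* x)) refl (θ ^ i) y z x)
      (V-+ (p x w i i≤n) (q x w i i≤n))
      where open CubicSolver

    acts-neg : ∀ y → Acts y → Acts (-ᶜ y)
    acts-neg y p x w i i≤n = subst V
      (solve 3 (λ t y x → :- (t :* (y :* x)) := t :* (:- y :* x)) refl (θ ^ i) y x)
      (V-neg (p x w i i≤n))
      where open CubicSolver

    acts-* : ∀ y z → Acts y → Acts z → Acts (y *ᶜ z)
    acts-* y z p q x w i i≤n = subst (λ u → V (θ ^ i *ᶜ u)) (sym (*ᶜ-assoc y z x)) (p (z *ᶜ x) (q x w) i i≤n)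

    W-1 : W 1ᶜ
    W-1 i i≤n = subst V (sym (*-identityʳ (θ ^ i))) (bounded n i i≤n)
      where
      m = denominator θ
      bounded : ∀ n i → i ℕ.≤ n → IntegerCoords (scalar (m ℕ.^ n) *ᶜ θ ^ i)
      bounded n zero z≤n = subst IntegerCoords (sym (*-identityʳ (scalar (m ℕ.^ n)))) (embed-integerCoords (+ (m ℕ.^ n)))
      bounded (suc n) (suc i) (s≤s i≤n) = subst IntegerCoords
        (trans (solve 4 (λ m k t p → (m :* t) :* (k :* p) := (m :* k) :* (t :* p)) refl (scalar m) (scalar (m ℕ.^ n)) θ (θ ^ i))
               (cong (_*ᶜ θ ^ suc i) (sym (scalar-* m (m ℕ.^ n)))))
        (*-integerCoords (denominator-clears θ) (bounded n i i≤n))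
        where open CubicSolver

    -- Starting from 1, the action of z keeps all zᵏ in W; its case i = 0 says that Mzᵏ has integer
    -- coordinates. So the norms of the Mzᵏ are integers, they form a geometric sequence of ratio
    -- norm z, and the first is nonzero because M is.
    acts⇒norm-isInteger : ∀ z → Acts z → IsInteger (norm z)
    acts⇒norm-isInteger z act = geometric⇒isInteger (λ k → norm (M *ᶜ z ^ k)) (norm z)
      (λ k → norm-isInteger (subst V (*-identityˡ (z ^ k)) (W-powers k 0 z≤n)))
      (λ k → trans (cong norm (solve 3 (λ m z p → m :* (z :* p) := m :* p :* z) refl M z (z ^ k))) (norm-* (M *ᶜ z ^ k) z))
      (λ e → ℕ.≢-nonZero⁻¹ _ {{ℕP.m^n≢0 (denominator θ) n {{denominator≢0 θ}}}}
        (ℤP.+-injective (ℤ→ℚ-injective (cong c₀ (trans (sym (*-identityʳ M)) (norm≡0⇒≡0 (M *ᶜ 1ᶜ) e))))))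
      where
      open CubicSolver
      W-powers : ∀ k → W (z ^ k)
      W-powers zero    = W-1
      W-powers (suc k) = act (z ^ k) (W-powers k)

  -- The characteristic polynomial and the integrality of its coefficients.

  -- The determinant has exactly four coefficients, so the last clause is by computation.
  charPoly-coefficients : ∀ x → Polynomial._≈ₚ_ ℚ.+-*-rawRing
    (ℚ.- norm x ∷ middle x ∷ ℚ.- trace x ∷ 1ℚ ∷ []) (charPoly x)
  charPoly-coefficients ⟨ a , b , c ⟩ = λ where
      0 → solve 4 (λ D a b c → :- normExpr D a b c := coeffExpr 0 D a b c) refl D a b c
      1 → solve 4 (λ D a b c → middleExpr D a b c := coeffExpr 1 D a b c) refl D a b c
      2 → solve 4 (λ D a b c → :- traceExpr D a b c := coeffExpr 2 D a b c) refl D a b c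
      3 → solve 4 (λ D a b c → con 1ℚ := coeffExpr 3 D a b c) refl D a b c
      (suc (suc (suc (suc k)))) → refl
    where open ℚSolver

  -- This is F(1) for the characteristic polynomial F of θ; the norm of 1 + θ is likewise -F(-1).
  norm[1-θ] : ∀ θ → norm (1ᶜ +ᶜ -ᶜ θ) ≡ 1ℚ ℚ.- trace θ ℚ.+ middle θ ℚ.- norm θ
  norm[1-θ] ⟨ a , b , c ⟩ = solve 4 (λ D a b c →
    normExpr D (con 1ℚ :+ :- a) (con 0ℚ :+ :- b) (con 0ℚ :+ :- c) :=
    con 1ℚ :- traceExpr D a b c :+ middleExpr D a b c :- normExpr D a b c) refl D a b c
    where open ℚSolver

  norm[1+θ] : ∀ θ → norm (1ᶜ +ᶜ θ) ≡ 1ℚ ℚ.+ trace θ ℚ.+ middle θ ℚ.+ norm θ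
  norm[1+θ] ⟨ a , b , c ⟩ = solve 4 (λ D a b c →
    normExpr D (con 1ℚ :+ a) (con 0ℚ :+ b) (con 0ℚ :+ c) :=
    con 1ℚ :+ traceExpr D a b c :+ middleExpr D a b c :+ normExpr D a b c) refl D a b c
    where open ℚSolver

  -- This is F(i)F(-i) for the characteristic polynomial F of θ, where F(±i) = (T - N) ± (S - 1)i.
  norm[1+θ²] : ∀ θ → norm (1ᶜ +ᶜ θ *ᶜ θ) ≡
    (trace θ ℚ.- norm θ) ℚ.* (trace θ ℚ.- norm θ) ℚ.+ (middle θ ℚ.- 1ℚ) ℚ.* (middle θ ℚ.- 1ℚ)
  norm[1+θ²] ⟨ a , b , c ⟩ = solve 4 (λ D a b c →
    normExpr D (con 1ℚ :+ (a :* a :+ D :* (b :* c :+ c :* b)))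
               (con 0ℚ :+ (a :* b :+ b :* a :+ D :* (c :* c)))
               (con 0ℚ :+ (a :* c :+ b :* b :+ c :* a)) :=
    (traceExpr D a b c :- normExpr D a b c) :* (traceExpr D a b c :- normExpr D a b c)
      :+ (middleExpr D a b c :- con 1ℚ) :* (middleExpr D a b c :- con 1ℚ)) refl D a b c
    where open ℚSolver

  record IntegralCoefficients (θ : Cubic) : Set where
    field
      T S N    : ℤ
      trace≡T  : trace θ ≡ ℤ→ℚ T
      middle≡S : middle θ ≡ ℤ→ℚ S
      norm≡N   : norm θ ≡ ℤ→ℚ N

  integral⇒integralCoefficients : ∀ θ → Integral θ → IntegralCoefficients θ
  integral⇒integralCoefficients θ (cs , root) =
    let open IntegralElement θ cs root
        norm∈ℤ = acts⇒norm-isInteger θ acts-θ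
        trace∈ℤ , middle∈ℤ = integral-coefficients (trace θ) (middle θ) (norm θ) norm∈ℤ
          (subst IsInteger (norm[1-θ] θ) (acts⇒norm-isInteger (1ᶜ +ᶜ -ᶜ θ) (acts-+ 1ᶜ (-ᶜ θ) acts-1 (acts-neg θ acts-θ))))
          (subst IsInteger (norm[1+θ] θ) (acts⇒norm-isInteger (1ᶜ +ᶜ θ) (acts-+ 1ᶜ θ acts-1 acts-θ)))
          (subst IsInteger (norm[1+θ²] θ)
            (acts⇒norm-isInteger (1ᶜ +ᶜ θ *ᶜ θ) (acts-+ 1ᶜ (θ *ᶜ θ) acts-1 (acts-* θ θ acts-θ acts-θ))))
    in record { T = proj₁ trace∈ℤ ; S = proj₁ middle∈ℤ ; N = proj₁ norm∈ℤ
              ; trace≡T = proj₂ trace∈ℤ ; middle≡S = proj₂ middle∈ℤ ; norm≡N = proj₂ norm∈ℤ }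

  -- The resolvent of an element of the field.

  -- The left side is Q, the right side d(3b)³ + d²(3c)³. Cardano's substitution gives 3θ - T = 3b∛d
  -- + 3c∛d², so a disappears and the two summands are the cubes of 3b∛d and 3c∛d².
  resolventSum : ∀ θ → let b = c₁ θ ; c = c₂ θ in
    ℤ→ℚ (+ 27) ℚ.* norm θ ℚ.+ ℤ→ℚ (+ 2) ℚ.* (trace θ ℚ.* trace θ ℚ.* trace θ) ℚ.- ℤ→ℚ (+ 9) ℚ.* (trace θ ℚ.* middle θ)
    ≡ ℤ→ℚ (+ 27) ℚ.* (D ℚ.* (b ℚ.* b ℚ.* b) ℚ.+ D ℚ.* D ℚ.* (c ℚ.* c ℚ.* c))
  resolventSum ⟨ a , b , c ⟩ = solve 4 (λ D a b c → let T = traceExpr D a b c in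
      con (ℤ→ℚ (+ 27)) :* normExpr D a b c :+ con (ℤ→ℚ (+ 2)) :* (T :* T :* T) :- con (ℤ→ℚ (+ 9)) :* (T :* middleExpr D a b c)
      := con (ℤ→ℚ (+ 27)) :* (D :* (b :* b :* b) :+ D :* D :* (c :* c :* c))) refl D a b c
    where open ℚSolver

  resolventProduct : ∀ θ → let b = c₁ θ ; c = c₂ θ in
    trace θ ℚ.* trace θ ℚ.- ℤ→ℚ (+ 3) ℚ.* middle θ ≡ ℤ→ℚ (+ 9) ℚ.* (D ℚ.* (b ℚ.* c))
  resolventProduct ⟨ a , b , c ⟩ = solve 4 (λ D a b c →
      traceExpr D a b c :* traceExpr D a b c :- con (ℤ→ℚ (+ 3)) :* middleExpr D a b c
      := con (ℤ→ℚ (+ 9)) :* (D :* (b :* c))) refl D a b c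
    where open ℚSolver

  -- With β = 3b and γ = 3c the numbers dβ³ and d²γ³ have sum Q and product P³.
  resolventRoot : ∀ {θ} (coefficients : IntegralCoefficients θ) → let open IntegralCoefficients coefficients in
    Σ[ u ∈ ℤ ] Depressed.IsResolventRoot T S N u
      × (let β = (1ℚ ℚ.+ 1ℚ ℚ.+ 1ℚ) ℚ.* c₁ θ in D ℚ.* (β ℚ.* β ℚ.* β) ≡ ℤ→ℚ u)
  resolventRoot {θ@(⟨ a , b , c ⟩)} coefficients = u , ℚ⇒ℤ
      (var 0F :* var 0F :+ var 1F :* var 0F :+ var 2F) (con (+ 0)) (u Vec.∷ B Vec.∷ C Vec.∷ Vec.[])
      (subst (λ t → t ℚ.* t ℚ.+ ℤ→ℚ B ℚ.* t ℚ.+ ℤ→ℚ C ≡ 0ℚ) (proj₂ v∈ℤ) v-root) , proj₂ v∈ℤ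
    where
    open IntegralCoefficients coefficients
    open ℤSolver
    B = ℤ.- Depressed.Q T S N
    C = Depressed.P T S N ℤ.* Depressed.P T S N ℤ.* Depressed.P T S N
    β = (1ℚ ℚ.+ 1ℚ ℚ.+ 1ℚ) ℚ.* b
    v = D ℚ.* (β ℚ.* β ℚ.* β)
    t = var 0F
    s = var 1F
    n = var 2F
    p = t :* t :- con (+ 3) :* s
    q = con (+ 27) :* n :+ con (+ 2) :* (t :* t :* t) :- con (+ 9) :* (t :* s)

    v-root : v ℚ.* v ℚ.+ ℤ→ℚ B ℚ.* v ℚ.+ ℤ→ℚ C ≡ 0ℚ
    v-root = begin
      v ℚ.* v ℚ.+ ℤ→ℚ B ℚ.* v ℚ.+ ℤ→ℚ C
        ≡⟨ cong₂ (λ x y → v ℚ.* v ℚ.+ x ℚ.* v ℚ.+ y) (ℤ→ℚ-⟦⟧ (:- q) (T Vec.∷ S Vec.∷ N Vec.∷ Vec.[]))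
             (ℤ→ℚ-⟦⟧ (p :* p :* p) (T Vec.∷ S Vec.∷ N Vec.∷ Vec.[])) ⟩
      resolvent (sum (ℤ→ℚ T) (ℤ→ℚ S) (ℤ→ℚ N)) (root-product (ℤ→ℚ T) (ℤ→ℚ S))
        ≡⟨ cong₂ resolvent
             (trans (sym (cong₂ (λ t (s , n) → sum t s n) trace≡T (cong₂ _,_ middle≡S norm≡N))) (resolventSum θ))
             (trans (sym (cong₂ root-product trace≡T middle≡S)) (resolventProduct θ)) ⟩
      resolvent (ℤ→ℚ (+ 27) ℚ.* (D ℚ.* (b ℚ.* b ℚ.* b) ℚ.+ D ℚ.* D ℚ.* (c ℚ.* c ℚ.* c))) (ℤ→ℚ (+ 9) ℚ.* (D ℚ.* (b ℚ.* c)))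
        ≡⟨ Q.solve 3 (λ D b c →
             let β = (Q.con 1ℚ Q.:+ Q.con 1ℚ Q.:+ Q.con 1ℚ) Q.:* b
                 v = D Q.:* (β Q.:* β Q.:* β)
                 q = Q.con (ℤ→ℚ (+ 27)) Q.:* (D Q.:* (b Q.:* b Q.:* b) Q.:+ D Q.:* D Q.:* (c Q.:* c Q.:* c))
                 p = Q.con (ℤ→ℚ (+ 9)) Q.:* (D Q.:* (b Q.:* c))
             in v Q.:* v Q.:+ Q.:- q Q.:* v Q.:+ p Q.:* p Q.:* p Q.:= Q.con 0ℚ) refl D b c ⟩
      0ℚ ∎
      where
      sum : ℚ → ℚ → ℚ → ℚ
      sum t s n = ℤ→ℚ (+ 27) ℚ.* n ℚ.+ ℤ→ℚ (+ 2) ℚ.* (t ℚ.* t ℚ.* t) ℚ.- ℤ→ℚ (+ 9) ℚ.* (t ℚ.* s)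
      root-product : ℚ → ℚ → ℚ
      root-product t s = t ℚ.* t ℚ.- ℤ→ℚ (+ 3) ℚ.* s
      resolvent : ℚ → ℚ → ℚ
      resolvent q p = v ℚ.* v ℚ.+ ℚ.- q ℚ.* v ℚ.+ p ℚ.* p ℚ.* p

    -- Although b is merely rational, v is a root of a monic quadratic polynomial over ℤ.
    v∈ℤ : IsInteger v
    v∈ℤ = quadraticRoot⇒isInteger B C v v-root
    u = proj₁ v∈ℤ

  -- Bounds on the index of an integral element.

  index : ∀ {θ} → IntegralCoefficients θ → ℕ
  index coefficients = indexOf T S N
    where open IntegralCoefficients coefficients

  index-isElementIndex : ∀ {θ} (coefficients : IntegralCoefficients θ) → IsElementIndex θ (index coefficients)
  index-isElementIndex {θ} coefficients =
      (ℤ.- N ∷ S ∷ ℤ.- T ∷ + 1 ∷ [])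
    , subst (λ F → Polynomial._≈ₚ_ ℚ.+-*-rawRing F (charPoly θ)) (sym coefficients≡) (charPoly-coefficients θ)
    , index-isGcd T S N
    where
    open IntegralCoefficients coefficients
    coefficients≡ : map ℤ→ℚ (ℤ.- N ∷ S ∷ ℤ.- T ∷ + 1 ∷ []) ≡ ℚ.- norm θ ∷ middle θ ∷ ℚ.- trace θ ∷ 1ℚ ∷ []
    coefficients≡ = cong₂ _∷_ (trans (ℤ→ℚ-neg N) (cong ℚ.-_ (sym norm≡N)))
      (cong₂ _∷_ (sym middle≡S) (cong (_∷ 1ℚ ∷ []) (trans (ℤ→ℚ-neg T) (cong ℚ.-_ (sym trace≡T)))))

  -- The index divides 6 = 3 · 2, and the resolvent root d(3b)³ excludes the factor 3.
  index∣2 : ∀ {θ} (coefficients : IntegralCoefficients θ) → index coefficients ∣ℕ 2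
  index∣2 coefficients = Coprimality.coprime-divisor {o = 2} (prime∤⇒coprime prime[3] 3∤index) (index∣6 T S N)
    where
    open IntegralCoefficients coefficients
    resolvent = resolventRoot coefficients
    3∤index : ¬ (3 ∣ℕ index coefficients)
    3∤index 3∣g =
      3∤-values T S N (proj₁ resolvent) (proj₁ (proj₂ resolvent))
        (via (index∣F[1] T S N)) (via (index∣F[-1] T S N)) (via (index∣F[0] T S N))
      where
      via : ∀ {x} → + indexOf T S N ∣ℤ x → + 3 ∣ℤ x
      via = ℤ∣.∣-trans (ℤ∣.∣ᵤ⇒∣ 3∣g)

  -- An even index would make the resolvent root u = d(3b)³ odd. It is even, since cube-freeness at
  -- the prime 2 says that 8 does not divide d.
  even⇒index∣1 : CubeFree d → 2 ∣ℕ ℤ.∣ d ∣ → ∀ {θ} (coefficients : IntegralCoefficients θ) → index coefficients ∣ℕ 1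
  even⇒index∣1 cube-free 2∣d {θ} coefficients =
    Coprimality.coprime-divisor {o = 1} (prime∤⇒coprime prime[2] 2∤index) (index∣2 coefficients)
    where
    open IntegralCoefficients coefficients
    β = (1ℚ ℚ.+ 1ℚ ℚ.+ 1ℚ) ℚ.* c₁ θ

    resolvent = resolventRoot coefficients
    u = proj₁ resolvent
    2∤index : ¬ (2 ∣ℕ index coefficients)
    2∤index 2∣g =
      2∤-resolventRoot T S N u (proj₁ (proj₂ resolvent)) (via (index∣F[1] T S N)) (via (index∣F[0] T S N))
        (rational-even-cube-multiple d β u (proj₂ (proj₂ resolvent)) 2∣d (cube-free 2 prime[2]))
      where
      via : ∀ {x} → + indexOf T S N ∣ℤ x → + 2 ∣ℤ x
      via = ℤ∣.∣-trans (ℤ∣.∣ᵤ⇒∣ 2∣g)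

  -- An element of even index for odd d.

  -- The generator ∛d would not serve: its polynomial x³ - d has the odd value -d at 0.
  θ₀ : Cubic
  θ₀ = ⟨ 0ℚ , 1ℚ , 1ℚ ⟩

  θ₀-integral : Integral θ₀
  θ₀-integral = cs , trans (cong₂ (λ a b → evaluate (embed a ∷ embed b ∷ embed 0ℚ ∷ 1ᶜ ∷ []) θ₀) eq₀ eq₁)
      (ext (solve 1 (λ D → value D zero := con 0ℚ) refl D)
           (solve 1 (λ D → value D (suc zero) := con 0ℚ) refl D)
           (solve 1 (λ D → value D (suc (suc zero)) := con 0ℚ) refl D))
    where
    open ℚSolver
    open Defs.Polynomial (NumberField.rawRing numberField) using (evaluate)
    cs = ℤ.- (d ℤ.* d ℤ.+ d) ∷ ℤ.- (+ 3 ℤ.* d) ∷ + 0 ∷ []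

    eq₀ : ℤ→ℚ (ℤ.- (d ℤ.* d ℤ.+ d)) ≡ ℚ.- (D ℚ.* D ℚ.+ D)
    eq₀ = ℤ→ℚ-⟦⟧ (Z.:- (Z.var 0F Z.:* Z.var 0F Z.:+ Z.var 0F)) (d Vec.∷ Vec.[])

    eq₁ : ℤ→ℚ (ℤ.- (+ 3 ℤ.* d)) ≡ ℚ.- (ℤ→ℚ (+ 3) ℚ.* D)
    eq₁ = ℤ→ℚ-⟦⟧ (Z.:- (Z.con (+ 3) Z.:* Z.var 0F)) (d Vec.∷ Vec.[])

    -- The polynomial is evaluated on triples of solver expressions, so that each coordinate of the
    -- equation becomes an identity in D alone.
    value : ∀ {n} → Polynomial n → Fin 3 → Polynomial n
    value D = Defs.Polynomial.evaluate (record
        { Carrier = Fin 3 → Polynomial _ ; _≈_ = _≡_ ; _+_ = λ x y i → x i :+ y i ; _*_ = product D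
        ; -_ = λ x i → :- x i ; 0# = λ _ → con 0ℚ ; 1# = triple (con 1ℚ) (con 0ℚ) (con 0ℚ) })
      (scalarExpr (:- (D :* D :+ D)) ∷ scalarExpr (:- (con (ℤ→ℚ (+ 3)) :* D)) ∷ scalarExpr (con 0ℚ) ∷ scalarExpr (con 1ℚ) ∷ [])
      (triple (con 0ℚ) (con 1ℚ) (con 1ℚ))
      where
      scalarExpr : ∀ {n} → Polynomial n → Fin 3 → Polynomial n
      scalarExpr q = triple q (con 0ℚ) (con 0ℚ)

  -- θ₀² - θ₀ - 2d = (d - 1) ∛d, and d ≠ 1 because 1 is a cube.
  ∛d∈ℚ⟨θ₀⟩ : ℚ⟨ θ₀ ⟩ ∛d
  ∛d∈ℚ⟨θ₀⟩ = respects equation (multiplication {x = embed s} {y = y} (rational s)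
      (addition {x = θ₀ *ᶜ θ₀} {y = -ᶜ θ₀ +ᶜ embed q} (multiplication {x = θ₀} {y = θ₀} generator generator)
        (addition {x = -ᶜ θ₀} {y = embed q} (negation generator) (rational q))))
    where
    open ℚSolver
    D-1≢0 : D ℚ.- 1ℚ ≢ 0ℚ
    D-1≢0 e = d-not-cube (+ 1 , sym (ℤ→ℚ-injective {d} {+ 1} (begin
      D                  ≡⟨ solve 1 (λ D → D := D :- con 1ℚ :+ con 1ℚ) refl D ⟩
      D ℚ.- 1ℚ ℚ.+ 1ℚ    ≡⟨ cong (ℚ._+ 1ℚ) e ⟩
      1ℚ                 ∎)))
    instance _ = ℚ.≢-nonZero D-1≢0
    s = ℚ.1/ (D ℚ.- 1ℚ)
    q = ℚ.- (D ℚ.+ D)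
    y = θ₀ *ᶜ θ₀ +ᶜ (-ᶜ θ₀ +ᶜ embed q)

    y≡ : y ≡ ⟨ 0ℚ , D ℚ.- 1ℚ , 0ℚ ⟩
    y≡ = ext
      (solve 1 (λ D → square D zero :+ (:- con 0ℚ :+ :- (D :+ D)) := con 0ℚ) refl D)
      (solve 1 (λ D → square D (suc zero) :+ (:- con 1ℚ :+ con 0ℚ) := D :- con 1ℚ) refl D)
      (solve 1 (λ D → square D (suc (suc zero)) :+ (:- con 1ℚ :+ con 0ℚ) := con 0ℚ) refl D)
      where
      square : ∀ {n} → Polynomial n → Fin 3 → Polynomial n
      square D = product D (triple (con 0ℚ) (con 1ℚ) (con 1ℚ)) (triple (con 0ℚ) (con 1ℚ) (con 1ℚ))

    equation : embed s *ᶜ y ≡ ∛d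
    equation = trans (cong (embed s *ᶜ_) y≡) (trans (embed-scales s ⟨ 0ℚ , D ℚ.- 1ℚ , 0ℚ ⟩)
      (ext (ℚP.*-zeroʳ s) (ℚP.*-inverseˡ (D ℚ.- 1ℚ)) (ℚP.*-zeroʳ s)))

  ℚ⟨⟩-minimal : ∀ {x y} → ℚ⟨ y ⟩ x → ∀ {z} → ℚ⟨ x ⟩ z → ℚ⟨ y ⟩ z
  ℚ⟨⟩-minimal x∈ generator                    = x∈
  ℚ⟨⟩-minimal x∈ (rational q)                 = rational q
  ℚ⟨⟩-minimal x∈ (addition {x} {y} p q)       = addition {x = x} {y = y} (ℚ⟨⟩-minimal x∈ p) (ℚ⟨⟩-minimal x∈ q)
  ℚ⟨⟩-minimal x∈ (negation p)                 = negation (ℚ⟨⟩-minimal x∈ p)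
  ℚ⟨⟩-minimal x∈ (multiplication {x} {y} p q) = multiplication {x = x} {y = y} (ℚ⟨⟩-minimal x∈ p) (ℚ⟨⟩-minimal x∈ q)
  ℚ⟨⟩-minimal x∈ (inverse {x} {y} p e)        = inverse {x = x} {y = y} (ℚ⟨⟩-minimal x∈ p) e
  ℚ⟨⟩-minimal x∈ (respects e p)               = respects e (ℚ⟨⟩-minimal x∈ p)

  θ₀-primitive : Primitive θ₀
  θ₀-primitive x = ℚ⟨⟩-minimal ∛d∈ℚ⟨θ₀⟩ (∛d-primitive x)

  odd⇒2∣index[θ₀] : ¬ (2 ∣ℕ ℤ.∣ d ∣) → (coefficients : IntegralCoefficients θ₀) → 2 ∣ℕ index coefficients
  odd⇒2∣index[θ₀] 2∤d coefficients =
    -- The coefficients are given abstractly; injectivity of ℤ → ℚ identifies them as T = 0, S = -3d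
    -- and N = d² + d.
    go T S N (ℤ→ℚ-injective {T} {+ 0} (sym trace≡T)) (ℤ→ℚ-injective {S} {ℤ.- (+ 3 ℤ.* d)} (trans (sym middle≡S) S-eq))
             (ℤ→ℚ-injective {N} {d ℤ.* d ℤ.+ d} (trans (sym norm≡N) N-eq))
    where
    open IntegralCoefficients coefficients
    S-eq : middle θ₀ ≡ ℤ→ℚ (ℤ.- (+ 3 ℤ.* d))
    S-eq = trans (solve 1 (λ D → middleExpr D (con 0ℚ) (con 1ℚ) (con 1ℚ) := :- (con (ℤ→ℚ (+ 3)) :* D)) refl D)
      (sym (ℤ→ℚ-⟦⟧ (Z.:- (Z.con (+ 3) Z.:* Z.var 0F)) (d Vec.∷ Vec.[])))
      where open ℚSolver
    N-eq : norm θ₀ ≡ ℤ→ℚ (d ℤ.* d ℤ.+ d)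
    N-eq = trans (solve 1 (λ D → normExpr D (con 0ℚ) (con 1ℚ) (con 1ℚ) := D :* D :+ D) refl D)
      (sym (ℤ→ℚ-⟦⟧ (Z.var 0F Z.:* Z.var 0F Z.:+ Z.var 0F) (d Vec.∷ Vec.[])))
      where open ℚSolver

    2∣d+1 : + 2 ∣ℤ d ℤ.+ + 1
    2∣d+1 with euclidsLemma ℤ.∣ d ∣ ℤ.∣ d ℤ.+ + 1 ∣ prime[2]
                (subst (2 ∣ℕ_) (ℤP.abs-* d (d ℤ.+ + 1)) (ℤ∣.∣⇒∣ᵤ (subst (+ 2 ∣ℤ_)
                  (Z.solve 1 (λ d → d Z.:* d Z.:+ d Z.:= d Z.:* (d Z.:+ Z.con (+ 1))) refl d) (2∣x²+x d))))
    ... | inj₁ 2∣d   = ⊥-elim (2∤d 2∣d)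
    ... | inj₂ 2∣d+1 = ℤ∣.∣ᵤ⇒∣ 2∣d+1

    go : ∀ T S N → T ≡ + 0 → S ≡ ℤ.- (+ 3 ℤ.* d) → N ≡ d ℤ.* d ℤ.+ d → 2 ∣ℕ indexOf T S N
    -- Each of the values at 1, -1 and 0 is a combination of the even numbers d + 1, 2 and d² + d.
    go _ _ _ refl refl refl = ∣index (+ 0) (ℤ.- (+ 3 ℤ.* d)) (d ℤ.* d ℤ.+ d)
      (subst (+ 2 ∣ℤ_)
        (Z.solve 1 (λ d → d Z.:+ Z.con (+ 1) Z.:+ Z.con (+ 2) Z.:* (Z.:- d Z.:- d) Z.:- (d Z.:* d Z.:+ d) Z.:= F d (Z.con (+ 1))) refl d)
        (ℤ∣.∣m∣n⇒∣m-n (ℤ∣.∣m∣n⇒∣m+n 2∣d+1 (ℤ∣.∣m⇒∣m*n (ℤ.- d ℤ.- d) ℤ∣.∣-refl)) (2∣x²+x d)))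
      (subst (+ 2 ∣ℤ_)
        (Z.solve 1 (λ d → d Z.:+ Z.con (+ 1) Z.:+ Z.con (+ 2) Z.:* (d Z.:- Z.con (+ 1)) Z.:- (d Z.:* d Z.:+ d) Z.:= F d (Z.:- Z.con (+ 1))) refl d)
        (ℤ∣.∣m∣n⇒∣m-n (ℤ∣.∣m∣n⇒∣m+n 2∣d+1 (ℤ∣.∣m⇒∣m*n (d ℤ.- + 1) ℤ∣.∣-refl)) (2∣x²+x d)))
      (subst (+ 2 ∣ℤ_)
        (Z.solve 1 (λ d → Z.:- (d Z.:* d Z.:+ d) Z.:= F d (Z.con (+ 0))) refl d)
        (ℤ∣.∣m⇒∣-m (2∣x²+x d)))
      (ℕ∣.divides 3 refl)
      where
      F : ∀ {n} → Z.Polynomial n → Z.Polynomial n → Z.Polynomial n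
      F d x = charPolyAtExpr (Z.con (+ 0)) (Z.:- (Z.con (+ 3) Z.:* d)) (d Z.:* d Z.:+ d) x

  -- The index of the field.

  elementIndex : PrimitiveInteger → ℕ
  elementIndex (θ , integral , _) = index (integral⇒integralCoefficients θ integral)

  isFieldIndex : ∀ l → IsLcm elementIndex l → IsFieldIndex l
  isFieldIndex l isLcm =
    elementIndex , (λ (θ , integral , _) → index-isElementIndex (integral⇒integralCoefficients θ integral)) , isLcm

corollary1p1 : (d : ℤ) → CubeFree d → (d-not-cube : ¬ PerfectCube d) →
    (¬ (+ 2 ∣ d) → NumberField.IsFieldIndex (ℚ[∛ d ] d-not-cube) 2) ×
    (+ 2 ∣ d → NumberField.IsFieldIndex (ℚ[∛ d ] d-not-cube) 1)
corollary1p1 d cube-free d-not-cube =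
    (λ 2∤d → isFieldIndex 2
      ( (λ (θ , integral , _) → index∣2 (integral⇒integralCoefficients θ integral))
      -- A common multiple of all indices is a multiple of the index of `θ₀`, which is even.
      , λ m index∣m → ∣-trans (odd⇒2∣index[θ₀] 2∤d (integral⇒integralCoefficients θ₀ θ₀-integral))
                              (index∣m (θ₀ , θ₀-integral , θ₀-primitive))))
  , (λ 2∣d → isFieldIndex 1
      ( (λ (θ , integral , _) → even⇒index∣1 cube-free 2∣d (integral⇒integralCoefficients θ integral))
      , λ m _ → 1∣ m))
  where
  open CubicField d d-not-cube
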